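{- There are no admissible vectors for diagrams in any of the extended affine skew-symmetrizable mutation classes $G_2^{(*,+)}$, $G_2^{(*,*)}$, $F_4^{(*,+)}$, $F_4^{(*,*)}$.
   Context: $G_2^{(*,+)}$, $G_2^{(*,*)}$, $F_4^{(*,+)}$, $F_4^{(*,*)}$ denote the four exceptional non-skew-symmetric mutation-finite classes of extended affine (elliptic) type in the classification of Felikson–Shapiro–Tumarkin ("Skew-symmetric cluster algebras of finite mutation type"/"Cluster algebras of finite mutation type via unfoldings"). For a skew-symmetrizable $n\times n$ matrix $B$ (with $BD$ skew-symmetric for a positive integer diagonal $D$) and $\boldsymbol b\in\mathbb Z^n$, form the $(n+1)\times n$ matrix $\widetilde B$ consisting of $B$ with extra last row $-\boldsymbol b$; mutation $\mu_k$ ($1\le k\le n$): $b'_{ij}=-b_{ij}$ if $k\in\{i,j\}$, else $b'_{ij}=b_{ij}+\mathrm{sgn}(b_{ik})[b_{ik}b_{kj}]_+$. $\boldsymbol b$ is admissible (for $B$, or its diagram) if $\boldsymbol b\ne0$ and the mutation class of $\widetilde B$ is finite. The diagram of $B$ has an arrow $v_i\to v_j$ of weight $|b_{ij}b_{ji}|$ whenever $b_{ij}>0$. -}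

module Defs where

open import Data.Nat using (ℕ; zero; suc)
open import Data.Integer using (ℤ; +_; -_; _*_; _+_; _⊔_; _<?_; ∣_∣; 0ℤ; 1ℤ; -1ℤ)
open import Data.Fin using (Fin; zero; suc; inject₁; _≟_)
open import Data.Fin.Permutation using (Permutation′; _⟨$⟩ʳ_)
open import Data.Vec using (Vec; []; _∷_; lookup)
open import Data.List using (List; []; _∷_)
open import Data.List.Relation.Unary.Any using (Any)
open import Data.Bool using (if_then_else_; _∨_)
open import Data.Product using (Σ; _×_)
open import Relation.Nullary using (¬_; does)
open import Relation.Binary.PropositionalEquality using (_≡_)

Mat : ℕ → ℕ → Set
Mat m n = Fin m → Fin n → ℤ

sgn : ℤ → ℤ
sgn x with does (0ℤ <? x) | does (x <? 0ℤ)
... | Data.Bool.true  | _ = 1ℤ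
... | Data.Bool.false | Data.Bool.true = -1ℤ
... | Data.Bool.false | Data.Bool.false = 0ℤ

pos : ℤ → ℤ
pos x = x ⊔ 0ℤ

-- Mutation μ_k (1 ≤ k ≤ n) of an m × n matrix whose first n rows are the
-- principal part; `e` sends the column index k to the row index of v_k.
--   b'_ij = -b_ij                              if k ∈ {i, j}
--   b'_ij = b_ij + sgn(b_ik) [b_ik b_kj]_+     otherwise
mutGen : ∀ {m n} → (Fin n → Fin m) → Fin n → Mat m n → Mat m n
mutGen e k B i j =
  if does (i ≟ e k) ∨ does (j ≟ k)
  then - B i j
  else B i j + sgn (B i k) * pos (B i k * B (e k) j)

μ : ∀ {n} → Fin n → Mat n n → Mat n n
μ k = mutGen (λ i → i) k

μ̃ : ∀ {n} → Fin n → Mat (suc n) n → Mat (suc n) n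
μ̃ k = mutGen inject₁ k

mutSeq : ∀ {m n} → (Fin n → Mat m n → Mat m n) → List (Fin n) → Mat m n → Mat m n
mutSeq f []       B = B
mutSeq f (k ∷ ks) B = mutSeq f ks (f k B)

SkewSymmetrizable : ∀ {n} → Mat n n → Set
SkewSymmetrizable {n} B =
  Σ (Fin n → ℕ) λ d →
    (∀ i → Σ ℕ λ k → d i ≡ suc k) ×
    (∀ i j → B i j * (+ d j) ≡ - (B j i * (+ d i)))

extendRow : ∀ {n} {A : Set} → (Fin n → A) → A → Fin (suc n) → A
extendRow {zero}  f a zero    = a
extendRow {suc n} f a zero    = f zero
extendRow {suc n} f a (suc i) = extendRow (λ x → f (suc x)) a i

extend : ∀ {n} → Mat n n → (Fin n → ℤ) → Mat (suc n) n
extend B b i j = extendRow (λ i′ → B i′ j) (- b j) i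

FiniteMutationClass : ∀ {n} → Mat (suc n) n → Set
FiniteMutationClass {n} B̃ =
  Σ (List (Mat (suc n) n)) λ L →
    ∀ (ks : List (Fin n)) →
      Any (λ M → ∀ i j → mutSeq μ̃ ks B̃ i j ≡ M i j) L

Admissible : ∀ {n} → Mat n n → (Fin n → ℤ) → Set
Admissible B b = (¬ (∀ i → b i ≡ 0ℤ)) × FiniteMutationClass (extend B b)

-- The diagram of B: weight of the arrow v_i → v_j, namely |b_ij b_ji| if
-- b_ij > 0, and 0 (no arrow v_i → v_j) otherwise.
diagram : ∀ {n} → Mat n n → Fin n → Fin n → ℕ
diagram B i j = if does (0ℤ <? B i j) then ∣ B i j * B j i ∣ else 0

-- The diagram of B lies in the mutation class of the diagram of B₀
-- (mutation classes of diagrams are taken up to relabelling of vertices):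
-- some mutation of B₀ has a diagram isomorphic to the diagram of B.
DiagramInClassOf : ∀ {n} → Mat n n → Mat n n → Set
DiagramInClassOf {n} B₀ B =
  Σ (List (Fin n)) λ ks → Σ (Permutation′ n) λ σ →
    ∀ i j → diagram (mutSeq μ ks B₀) i j ≡ diagram B (σ ⟨$⟩ʳ i) (σ ⟨$⟩ʳ j)

data ExtAffineType : Set where
  G₂⁽*,+⁾ G₂⁽*,*⁾ F₄⁽*,+⁾ F₄⁽*,*⁾ : ExtAffineType

rank : ExtAffineType → ℕ
rank G₂⁽*,+⁾ = 4
rank G₂⁽*,*⁾ = 4
rank F₄⁽*,+⁾ = 6
rank F₄⁽*,*⁾ = 6

fromRows : ∀ {n} → Vec (Vec ℤ n) n → Mat n n
fromRows rows i j = lookup (lookup rows i) j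

-- Representative exchange matrices.  In each, vertices 0,1
-- are the doubled vertex (arrow 0 → 1 of weight 4) and the oriented
-- triangles 0 → 1 → v → 0 are attached to each neighbour v.
-- G₂⁽*,+⁾ : folding of E₆⁽¹'¹⁾ ; symmetrizer d = (3,3,1,1)
-- G₂⁽*,*⁾ : folding of D₄⁽¹'¹⁾ ; symmetrizer d = (3,3,1,3)
-- F₄⁽*,+⁾ : folding of E₆⁽¹'¹⁾ ; symmetrizer d = (2,2,1,1,2,2)
-- F₄⁽*,*⁾ : folding of E₇⁽¹'¹⁾ ; symmetrizer d = (2,2,1,1,1,2)
representative : (X : ExtAffineType) → Mat (rank X) (rank X)
representative G₂⁽*,+⁾ = fromRows
  ( (+ 0 ∷ + 2 ∷ - + 3 ∷ + 0 ∷ [])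
  ∷ (- + 2 ∷ + 0 ∷ + 3 ∷ + 0 ∷ [])
  ∷ (+ 1 ∷ - + 1 ∷ + 0 ∷ + 1 ∷ [])
  ∷ (+ 0 ∷ + 0 ∷ - + 1 ∷ + 0 ∷ [])
  ∷ [])
representative G₂⁽*,*⁾ = fromRows
  ( (+ 0 ∷ + 2 ∷ - + 3 ∷ - + 1 ∷ [])
  ∷ (- + 2 ∷ + 0 ∷ + 3 ∷ + 1 ∷ [])
  ∷ (+ 1 ∷ - + 1 ∷ + 0 ∷ + 0 ∷ [])
  ∷ (+ 1 ∷ - + 1 ∷ + 0 ∷ + 0 ∷ [])
  ∷ [])
representative F₄⁽*,+⁾ = fromRows
  ( (+ 0 ∷ + 2 ∷ - + 2 ∷ + 0 ∷ - + 1 ∷ + 0 ∷ [])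
  ∷ (- + 2 ∷ + 0 ∷ + 2 ∷ + 0 ∷ + 1 ∷ + 0 ∷ [])
  ∷ (+ 1 ∷ - + 1 ∷ + 0 ∷ + 1 ∷ + 0 ∷ + 0 ∷ [])
  ∷ (+ 0 ∷ + 0 ∷ - + 1 ∷ + 0 ∷ + 0 ∷ + 0 ∷ [])
  ∷ (+ 1 ∷ - + 1 ∷ + 0 ∷ + 0 ∷ + 0 ∷ + 1 ∷ [])
  ∷ (+ 0 ∷ + 0 ∷ + 0 ∷ + 0 ∷ - + 1 ∷ + 0 ∷ [])
  ∷ [])
representative F₄⁽*,*⁾ = fromRows
  ( (+ 0 ∷ + 2 ∷ - + 2 ∷ + 0 ∷ + 0 ∷ - + 1 ∷ [])
  ∷ (- + 2 ∷ + 0 ∷ + 2 ∷ + 0 ∷ + 0 ∷ + 1 ∷ [])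
  ∷ (+ 1 ∷ - + 1 ∷ + 0 ∷ + 1 ∷ + 0 ∷ + 0 ∷ [])
  ∷ (+ 0 ∷ + 0 ∷ - + 1 ∷ + 0 ∷ + 1 ∷ + 0 ∷ [])
  ∷ (+ 0 ∷ + 0 ∷ + 0 ∷ - + 1 ∷ + 0 ∷ + 0 ∷ [])
  ∷ (+ 1 ∷ - + 1 ∷ + 0 ∷ + 0 ∷ + 0 ∷ + 0 ∷ [])
  ∷ [])

{-# OPTIONS --safe #-}

-- Only the frozen row matters: the class is finite only if its entries stay bounded.
-- Mutating alternately at the ends of a double arrow i → j makes the row entries grow
-- linearly unless r_i ≥ 0 and r_j = − r_i.  In each representative this holds for the
-- arrow 0 → 1; following a suitable mutation sequence to another double arrow i → j, and
-- recording the sign of every entry at which one mutates, one finds that r_i is a strictly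
-- negative combination of all the nonnegative parameters introduced so far.  As r_i ≥ 0,
-- every parameter vanishes, and hence so does the row.
--
-- For a general B in the class, two skew-symmetrizable matrices with the same diagram are
-- conjugate by a positive real diagonal matrix, and this persists under mutation.  So B
-- can be mutated to a matrix conjugate to the representative; since the diagram is
-- connected, the conjugating matrix is rational up to a scalar, and the frozen row of B
-- becomes, after clearing denominators, an integral frozen row of the representative.
module Submission where

open import Defs
open import Data.Bool using (if_then_else_)
open import Data.Empty using (⊥-elim)
open import Data.Fin using (Fin; zero; suc; inject₁; fromℕ; _≟_; #_)
open import Data.Fin.Permutation using (Permutation′; _⟨$⟩ʳ_; _⟨$⟩ˡ_; inverseˡ; inverseʳ)
open import Data.Fin.Properties using (all?; inject₁-injective; fromℕ≢inject₁)
open import Data.Integer using (ℤ; +_; -[1+_]; +[1+_]; -_; _+_; _*_; _≤_; _<_; _<?_; ∣_∣; 0ℤ; 1ℤ; -1ℤ; +≤+)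
import Data.Integer as ℤ using (NonZero)
import Data.Integer.Properties as ℤ
open import Data.Integer.Tactic.RingSolver using (solve-∀)
open import Data.List using (List; []; _∷_; _++_; map)
open import Data.List.Relation.Unary.Any using (Any; here; there)
open import Data.Maybe as Maybe using (Maybe; just; nothing)
open import Data.Maybe.Relation.Unary.Any using (just) renaming (Any to MaybeAny; dec to maybeAny?)
open import Data.Nat as ℕ using (ℕ; zero; suc; z≤n; NonZero)
import Data.Nat.Properties as ℕ
import Data.Nat.Tactic.RingSolver as ℕ-Solver
open import Data.Product using (Σ; _×_; _,_; proj₁; proj₂; ∃-syntax)
open import Data.Sum using (_⊎_; inj₁; inj₂)
open import Data.Unit using (⊤; tt)
open import Data.Vec as Vec using (Vec; []; _∷_; lookup)
open import Data.Vec.Relation.Unary.All as All using (All; []; _∷_)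
open import Function using (_∘_)
open import Relation.Binary.Definitions using (tri<; tri≈; tri>)
open import Relation.Binary.PropositionalEquality
open import Relation.Nullary using (¬_; yes; no; does; Dec)
open import Relation.Nullary.Decidable using (True; toWitness; map′; _×-dec_; _⊎-dec_)

private
  variable
    m n : ℕ

-- Matrix mutation and the signs in its exchange term.

exch : ℤ → ℤ → ℤ
exch +[1+ x ] +[1+ y ] = +[1+ x ] * +[1+ y ]
exch -[1+ x ] -[1+ y ] = - (-[1+ x ] * -[1+ y ])
exch _        _        = 0ℤ

sgn*pos≡exch : ∀ x y → sgn x * pos (x * y) ≡ exch x y
sgn*pos≡exch (+ zero)  y         = refl
sgn*pos≡exch +[1+ x ]  (+ zero)  rewrite ℕ.*-zeroʳ x = refl
sgn*pos≡exch +[1+ x ]  +[1+ y ]  = ℤ.*-identityˡ _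
sgn*pos≡exch +[1+ x ]  -[1+ y ]  = refl
sgn*pos≡exch -[1+ x ]  (+ zero)  rewrite ℕ.*-zeroʳ x = refl
sgn*pos≡exch -[1+ x ]  +[1+ y ]  = refl
sgn*pos≡exch -[1+ x ]  -[1+ y ]  = ℤ.-1*i≡-i _

exch-neg : ∀ x y → exch (- x) (- y) ≡ - exch x y
exch-neg (+ zero) y         = refl
exch-neg +[1+ x ] (+ zero)  = refl
exch-neg +[1+ x ] +[1+ y ]  = refl
exch-neg +[1+ x ] -[1+ y ]  = refl
exch-neg -[1+ x ] (+ zero)  = refl
exch-neg -[1+ x ] +[1+ y ]  = refl
exch-neg -[1+ x ] -[1+ y ]  = refl

-- Once the sign of `x` is fixed, the exchange term is linear in `x`, with a coefficient depending
-- on `y` alone; this lets linear forms be mutated symbolically.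
exch-≥0 : ∀ {x} y → 0ℤ ≤ x → exch x y ≡ x * pos y
exch-≥0 {+ zero}  y        _ = refl
exch-≥0 {+[1+ x ]} (+ zero) _ rewrite ℕ.*-zeroʳ x = refl
exch-≥0 {+[1+ x ]} +[1+ y ] _ = refl
exch-≥0 {+[1+ x ]} -[1+ y ] _ rewrite ℕ.*-zeroʳ x = refl

exch-≤0 : ∀ {x} y → x ≤ 0ℤ → exch x y ≡ x * pos (- y)
exch-≤0 {+ zero}   y        _ = refl
exch-≤0 { -[1+ x ]} (+ zero) _ rewrite ℕ.*-zeroʳ x = refl
exch-≤0 { -[1+ x ]} +[1+ y ] _ rewrite ℕ.*-zeroʳ x = refl
exch-≤0 { -[1+ x ]} -[1+ y ] _ = refl
exch-≤0 {+[1+ x ]} y (+≤+ ())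

exch-2 : ∀ x → exch x (+ 2) ≡ pos x + pos x
exch-2 (+ zero) = refl
exch-2 +[1+ x ] = trans (ℤ.*-comm +[1+ x ] (+ 2)) (lemma +[1+ x ])
  where
  lemma : ∀ z → + 2 * z ≡ z + z
  lemma = solve-∀
exch-2 -[1+ x ] = refl

μ-off : ∀ {k i j : Fin n} (B : Mat n n) → i ≢ k → j ≢ k →
  μ k B i j ≡ B i j + exch (B i k) (B k j)
μ-off {k = k} {i} {j} B i≢k j≢k with i ≟ k | j ≟ k
... | yes i≡k | _       = ⊥-elim (i≢k i≡k)
... | no  _   | yes j≡k = ⊥-elim (j≢k j≡k)
... | no  _   | no  _   = cong (λ z → B i j + z) (sgn*pos≡exch (B i k) (B k j))

μ-row : ∀ {k j : Fin n} (B : Mat n n) → μ k B k j ≡ - B k j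
μ-row {k = k} B with k ≟ k
... | yes _   = refl
... | no  k≢k = ⊥-elim (k≢k refl)

μ-col : ∀ {k i : Fin n} (B : Mat n n) → μ k B i k ≡ - B i k
μ-col {k = k} {i} B with i ≟ k | k ≟ k
... | yes _ | _       = refl
... | no  _ | yes _   = refl
... | no  _ | no  k≢k = ⊥-elim (k≢k refl)

data Position (k : Fin n) : Fin n → Fin n → Set where
  in-row : ∀ {j} → Position k k j
  in-col : ∀ {i} → Position k i k
  off    : ∀ {i j} → i ≢ k → j ≢ k → Position k i j

position : ∀ (k i j : Fin n) → Position k i j
position k i j with i ≟ k | j ≟ k
... | yes refl | _        = in-row
... | no  _    | yes refl = in-col
... | no  i≢k  | no  j≢k  = off i≢k j≢k

-- The second mutation sees both factors of the exchange term negated, so it adds the opposite term.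
μ-involutive : ∀ (k : Fin n) B i j → μ k (μ k B) i j ≡ B i j
μ-involutive k B i j with position k i j
... | in-row = trans (μ-row (μ k B)) (trans (cong -_ (μ-row B)) (ℤ.neg-involutive _))
... | in-col = trans (μ-col (μ k B)) (trans (cong -_ (μ-col B)) (ℤ.neg-involutive _))
... | off i≢k j≢k = begin
  μ k (μ k B) i j                                             ≡⟨ μ-off (μ k B) i≢k j≢k ⟩
  μ k B i j + exch (μ k B i k) (μ k B k j)                    ≡⟨ cong₂ _+_ (μ-off B i≢k j≢k) (cong₂ exch (μ-col B) (μ-row B)) ⟩
  B i j + exch (B i k) (B k j) + exch (- B i k) (- B k j)     ≡⟨ cong (λ z → B i j + exch (B i k) (B k j) + z) (exch-neg (B i k) (B k j)) ⟩
  B i j + exch (B i k) (B k j) + - exch (B i k) (B k j)       ≡⟨ lemma (B i j) (exch (B i k) (B k j)) ⟩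
  B i j                                                       ∎
  where
  open ≡-Reasoning
  lemma : ∀ x y → x + y + - y ≡ x
  lemma = solve-∀

mutSeq-∷ʳ : ∀ ks (k : Fin n) B → mutSeq μ (ks ++ k ∷ []) B ≡ μ k (mutSeq μ ks B)
mutSeq-∷ʳ []       k B = refl
mutSeq-∷ʳ (l ∷ ks) k B = mutSeq-∷ʳ ks k (μ l B)

Row : ℕ → Set
Row n = Fin n → ℤ

ρ : Fin n → Mat n n → Row n → Row n
ρ k B r j = if does (j ≟ k) then - r j else r j + exch (r k) (B k j)

ρ-at : ∀ (k : Fin n) B r → ρ k B r k ≡ - r k
ρ-at k B r with k ≟ k
... | yes _   = refl
... | no  k≢k = ⊥-elim (k≢k refl)

ρ-off : ∀ {k j : Fin n} B r → j ≢ k → ρ k B r j ≡ r j + exch (r k) (B k j)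
ρ-off {k = k} {j} B r j≢k with j ≟ k
... | yes j≡k = ⊥-elim (j≢k j≡k)
... | no  _   = refl

ρSeq : List (Fin n) → Mat n n → Row n → Row n
ρSeq []       B r = r
ρSeq (k ∷ ks) B r = ρSeq ks (μ k B) (ρ k B r)

-- Mutation only negates the entry at `k`, so that entry vanishes first, and with it all exchange
-- terms. Vanishing at the end of a sequence can thus be pulled back to its start.
ρ-zero : ∀ (k : Fin n) B r → (∀ j → ρ k B r j ≡ 0ℤ) → ∀ j → r j ≡ 0ℤ
ρ-zero k B r ρ≡0 j with j ≟ k
... | yes refl = ℤ.neg-injective (trans (sym (ρ-at k B r)) (ρ≡0 k))
... | no  j≢k  = begin
  r j                        ≡⟨ ℤ.+-identityʳ (r j) ⟨
  r j + exch 0ℤ (B k j)      ≡⟨ cong (λ z → r j + exch z (B k j)) rk≡0 ⟨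
  r j + exch (r k) (B k j)   ≡⟨ ρ-off B r j≢k ⟨
  ρ k B r j                  ≡⟨ ρ≡0 j ⟩
  0ℤ                         ∎
  where
  open ≡-Reasoning
  rk≡0 : r k ≡ 0ℤ
  rk≡0 = ℤ.neg-injective (trans (sym (ρ-at k B r)) (ρ≡0 k))

ρSeq-zero : ∀ ks B (r : Row n) → (∀ j → ρSeq ks B r j ≡ 0ℤ) → ∀ j → r j ≡ 0ℤ
ρSeq-zero []       B r r≡0 = r≡0
ρSeq-zero (k ∷ ks) B r r≡0 = ρ-zero k B r (ρSeq-zero ks (μ k B) (ρ k B r) r≡0)

-- One bound per column serves all mutation sequences; such bounds carry over to a rescaled row more
-- easily than a finite list of matrices.
Bounded : Mat n n → Row n → Set
Bounded {n} B r = Σ (Fin n → ℕ) λ N → ∀ ks j → ∣ ρSeq ks B r j ∣ ℕ.≤ N j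

bounded-ρ : ∀ {B} {r : Row n} k → Bounded B r → Bounded (μ k B) (ρ k B r)
bounded-ρ k (N , bnd) = N , λ ks → bnd (k ∷ ks)

bounded-ρSeq : ∀ ks {B} {r : Row n} → Bounded B r → Bounded (mutSeq μ ks B) (ρSeq ks B r)
bounded-ρSeq []       bd = bd
bounded-ρSeq (k ∷ ks) bd = bounded-ρSeq ks (bounded-ρ k bd)

extendRow-inject₁ : ∀ {A : Set} (f : Fin n → A) a i → extendRow f a (inject₁ i) ≡ f i
extendRow-inject₁ f a zero    = refl
extendRow-inject₁ f a (suc i) = extendRow-inject₁ (f ∘ suc) a i

extendRow-fromℕ : ∀ {A : Set} (f : Fin n → A) a → extendRow f a (fromℕ n) ≡ a
extendRow-fromℕ {zero}  f a = refl
extendRow-fromℕ {suc n} f a = extendRow-fromℕ (f ∘ suc) a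

-- Finite mutation classes have bounded frozen rows.

record Splits (M : Mat (suc n) n) (B : Mat n n) (r : Row n) : Set where
  field
    principal : ∀ i j → M (inject₁ i) j ≡ B i j
    lastRow   : ∀ j → M (fromℕ n) j ≡ r j
open Splits

splits-μ̃ : ∀ {M B} {r : Row n} k → Splits M B r → Splits (μ̃ k M) (μ k B) (ρ k B r)
splits-μ̃ {M = M} {B} {r} k S .principal i j
  with inject₁ i ≟ inject₁ k | i ≟ k
... | yes p | no  q = ⊥-elim (q (inject₁-injective p))
... | no  p | yes q = ⊥-elim (p (cong inject₁ q))
... | yes _ | yes _ = cong -_ (S .principal i j)
... | no  _ | no  _ with j ≟ k
...   | yes _ = cong -_ (S .principal i j)
...   | no  _ rewrite S .principal i j | S .principal i k | S .principal k j = refl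
splits-μ̃ {n} {M} {B} {r} k S .lastRow j with fromℕ n ≟ inject₁ k
... | yes p = ⊥-elim (fromℕ≢inject₁ p)
... | no  _ with j ≟ k
...   | yes _ = cong -_ (S .lastRow j)
...   | no  _ rewrite S .lastRow j | S .lastRow k | S .principal k j =
        cong (λ z → r j + z) (sgn*pos≡exch (r k) (B k j))

splits-mutSeq : ∀ ks {M B} {r : Row n} → Splits M B r →
  Splits (mutSeq μ̃ ks M) (mutSeq μ ks B) (ρSeq ks B r)
splits-mutSeq []       S = S
splits-mutSeq (k ∷ ks) S = splits-mutSeq ks (splits-μ̃ k S)

∑ : ∀ {A : Set} → (A → ℕ) → List A → ℕ
∑ f []       = 0
∑ f (x ∷ xs) = f x ℕ.+ ∑ f xs

any⇒≤∑ : ∀ {A : Set} {P : A → Set} (f : A → ℕ) {m xs} →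
  (∀ {x} → P x → m ≡ f x) → Any P xs → m ℕ.≤ ∑ f xs
any⇒≤∑ f eq (here px)                 = ℕ.≤-trans (ℕ.≤-reflexive (eq px)) (ℕ.m≤m+n _ _)
any⇒≤∑ f {xs = x ∷ _} eq (there any) = ℕ.≤-trans (any⇒≤∑ f eq any) (ℕ.m≤n+m _ (f x))

-- The sum of the last-row absolute values over the whole list dominates the value at any member.
finite⇒bounded : ∀ B (b : Row n) → FiniteMutationClass (extend B b) → Bounded B (-_ ∘ b)
finite⇒bounded {n} B b (L , inL) =
  (λ j → ∑ (λ M → ∣ M (fromℕ n) j ∣) L) ,
  λ ks j → any⇒≤∑ (λ M → ∣ M (fromℕ n) j ∣)
    (λ eq → cong ∣_∣ (trans (sym (splits-mutSeq ks splits₀ .lastRow j)) (eq (fromℕ n) j)))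
    (inL ks)
  where
  splits₀ : Splits (extend B b) B (-_ ∘ b)
  splits₀ .principal i j = extendRow-inject₁ (λ i′ → B i′ j) (- b j) i
  splits₀ .lastRow j     = extendRow-fromℕ (λ i′ → B i′ j) (- b j)

-- Double arrows force the frozen row to balance

record DoubleArrow (B : Mat n n) (i j : Fin n) : Set where
  constructor _,_
  field
    out : B i j ≡ + 2
    inn : B j i ≡ - + 2
open DoubleArrow

arrow-≢ : ∀ {B : Mat n n} {i j} → DoubleArrow B i j → i ≢ j
arrow-≢ (p , q) refl with trans (sym p) q
... | ()

-- After mutating at `i`, mutation at `j` again meets an outgoing double arrow, and the pair of
-- mutations restores the original one; so the turn can be iterated.
reverse-arrow : ∀ {B : Mat n n} {i j} → DoubleArrow B i j → DoubleArrow (μ i B) j i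
reverse-arrow {B = B} (p , q) = trans (μ-col B) (cong -_ q) , trans (μ-row B) (cong -_ p)

module _ {B : Mat n n} {i j} (a : DoubleArrow B i j) (r : Row n) where

  private
    y′ : ℤ
    y′ = r j + (pos (r i) + pos (r i))

    at-i : ρ i B r i ≡ - r i
    at-i = ρ-at i B r

    at-j : ρ i B r j ≡ y′
    at-j = trans (ρ-off B r (arrow-≢ a ∘ sym))
      (cong (λ z → r j + z) (trans (cong (exch (r i)) (a .out)) (exch-2 (r i))))

  turn-i : ρSeq (i ∷ j ∷ []) B r i ≡ - r i + (pos y′ + pos y′)
  turn-i = begin
    ρ j (μ i B) (ρ i B r) i                               ≡⟨ ρ-off (μ i B) (ρ i B r) (arrow-≢ a) ⟩
    ρ i B r i + exch (ρ i B r j) (μ i B j i)              ≡⟨ cong₂ _+_ at-i (cong₂ exch at-j (reverse-arrow a .out)) ⟩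
    - r i + exch y′ (+ 2)                                 ≡⟨ cong (λ z → - r i + z) (exch-2 y′) ⟩
    - r i + (pos y′ + pos y′)                             ∎
    where open ≡-Reasoning

  turn-j : ρSeq (i ∷ j ∷ []) B r j ≡ - y′
  turn-j = trans (ρ-at j (μ i B) (ρ i B r)) (cong -_ at-j)

  turn-arrow : DoubleArrow (mutSeq μ (i ∷ j ∷ []) B) i j
  turn-arrow = reverse-arrow (reverse-arrow a)

pos-≥0 : ∀ {x} → 0ℤ ≤ x → pos x ≡ x
pos-≥0 = ℤ.i≥j⇒i⊔j≡i

pos-≤0 : ∀ {x} → x ≤ 0ℤ → pos x ≡ 0ℤ
pos-≤0 = ℤ.i≤j⇒i⊔j≡j

-- The turn μ_i, μ_j preserves s = r_i + r_j and adds 2 s to r_i.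
grow : ∀ N {B : Mat n n} {i j} → DoubleArrow B i j → (r : Row n) →
  0ℤ ≤ r i → 0ℤ < r i + r j → ∃[ ks ] + N + r i ≤ ρSeq ks B r i
grow zero    a r x≥0 s>0 = [] , ℤ.≤-reflexive (ℤ.+-identityˡ _)
grow {n} (suc N) {B} {i} {j} a r x≥0 s>0 =
  let ks , le = grow N (turn-arrow a r) r″ x″≥0 s″>0
  in i ∷ j ∷ ks , ℤ.≤-trans (subst (λ z → + suc N + x ≤ + N + z) (sym r″i) step) le
  where
  r″ : Row n
  r″ = ρSeq (i ∷ j ∷ []) B r
  x y s : ℤ
  x = r i
  y = r j
  s = x + y
  y+x+x : y + (pos x + pos x) ≡ s + x
  y+x+x = trans (cong (λ z → y + (z + z)) (pos-≥0 x≥0)) (lemma x y)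
    where
    lemma : ∀ x y → y + (x + x) ≡ x + y + x
    lemma = solve-∀
  s+x≥0 : 0ℤ ≤ s + x
  s+x≥0 = ℤ.+-mono-≤ (ℤ.<⇒≤ s>0) x≥0
  r″i : r″ i ≡ x + (s + s)
  r″i = trans (turn-i a r)
    (trans (cong (λ z → - x + (z + z)) (trans (cong pos y+x+x) (pos-≥0 s+x≥0))) (lemma x s))
    where
    lemma : ∀ x s → - x + (s + x + (s + x)) ≡ x + (s + s)
    lemma = solve-∀
  r″j : r″ j ≡ - (s + x)
  r″j = trans (turn-j a r) (cong -_ y+x+x)
  x″≥0 : 0ℤ ≤ r″ i
  x″≥0 = subst (0ℤ ≤_) (sym r″i) (ℤ.+-mono-≤ x≥0 (ℤ.<⇒≤ (ℤ.+-mono-< s>0 s>0)))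
  s″>0 : 0ℤ < r″ i + r″ j
  s″>0 = subst (0ℤ <_) (sym (trans (cong₂ _+_ r″i r″j) (lemma x s))) s>0
    where
    lemma : ∀ x s → x + (s + s) + - (s + x) ≡ s
    lemma = solve-∀
  step : + suc N + x ≤ + N + (x + (s + s))
  step = begin
    + suc N + x           ≡⟨ cong (_+ x) (ℤ.pos-+ 1 N) ⟩
    + 1 + + N + x         ≡⟨ lemma (+ 1) (+ N) x ⟩
    + N + (x + + 1)       ≤⟨ ℤ.+-monoʳ-≤ (+ N) (ℤ.+-monoʳ-≤ x (ℤ.i<j⇒suc[i]≤j s+s>0)) ⟩
    + N + (x + (s + s))   ∎
    where
    open ℤ.≤-Reasoning
    s+s>0 : 0ℤ < s + s
    s+s>0 = ℤ.+-mono-< s>0 s>0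
    lemma : ∀ a b c → a + b + c ≡ b + (c + a)
    lemma = solve-∀

bounded⇒no-growth : ∀ {B : Mat n n} {i j} {r : Row n} → DoubleArrow B i j → Bounded B r →
  0ℤ ≤ r i → ¬ 0ℤ < r i + r j
bounded⇒no-growth {i = i} {r = r} a (N , bnd) x≥0 s>0
  -- From a nonnegative start, growth by one more than the bound at `i` breaks that bound.
  with ks , le ← grow (suc (N i)) a r x≥0 s>0
  = ℕ.<⇒≱ (big (ℤ.≤-trans (ℤ.+-monoʳ-≤ (+ suc (N i)) x≥0) le)) (bnd ks i)
  where
  big : ∀ {m z} → + suc m + 0ℤ ≤ z → m ℕ.< ∣ z ∣
  big {m} {+ z} (+≤+ le) = subst (ℕ._≤ z) (ℕ.+-identityʳ (suc m)) le

-- Exchange terms are odd under simultaneous negation of both factors. This mirrors the growth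
-- argument into one for decay.
ρSeq-neg : ∀ ks {B B′ : Mat n n} {r r′ : Row n} →
  (∀ i j → B′ i j ≡ - B i j) → (∀ j → r′ j ≡ - r j) →
  ∀ j → ρSeq ks B′ r′ j ≡ - ρSeq ks B r j
ρSeq-neg []       eB er = er
ρSeq-neg (k ∷ ks) {B} {B′} {r} {r′} eB er = ρSeq-neg ks eμ eρ
  where
  eμ : ∀ i j → μ k B′ i j ≡ - μ k B i j
  eμ i j with i ≟ k | j ≟ k
  ... | yes _ | _     = cong -_ (eB i j)
  ... | no  _ | yes _ = cong -_ (eB i j)
  ... | no  _ | no  _
      rewrite sgn*pos≡exch (B′ i k) (B′ k j) | sgn*pos≡exch (B i k) (B k j)
            | eB i j | eB i k | eB k j | exch-neg (B i k) (B k j)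
      = sym (ℤ.neg-distrib-+ (B i j) _)
  eρ : ∀ j → ρ k B′ r′ j ≡ - ρ k B r j
  eρ j with j ≟ k
  ... | yes _ = cong -_ (er j)
  ... | no  _ rewrite er j | er k | eB k j | exch-neg (r k) (B k j)
      = sym (ℤ.neg-distrib-+ (r j) _)

bounded-neg : ∀ {B : Mat n n} {r : Row n} → Bounded B r →
  Bounded (λ i j → - B i j) (λ j → - r j)
bounded-neg {B = B} {r} (N , bnd) = N , λ ks j → subst (ℕ._≤ N j)
  (sym (trans (cong ∣_∣ (ρSeq-neg ks (λ _ _ → refl) (λ _ → refl) j)) (ℤ.∣-i∣≡∣i∣ (ρSeq ks B r j))))
  (bnd ks j)

-- Negating matrix and row turns the arrow into one from `j` to `i` and decay into growth.
bounded⇒no-decay : ∀ {B : Mat n n} {i j} {r : Row n} → DoubleArrow B i j → Bounded B r →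
  r j ≤ 0ℤ → ¬ r i + r j < 0ℤ
bounded⇒no-decay {i = i} {j} {r} (p , q) bd y≤0 s<0 =
  bounded⇒no-growth (cong -_ q , cong -_ p) (bounded-neg bd) (ℤ.neg-mono-≤ y≤0)
    (subst (0ℤ <_) (lemma (r i) (r j)) (ℤ.neg-mono-< s<0))
  where
  lemma : ∀ x y → - (x + y) ≡ - y + - x
  lemma = solve-∀

-- Growth excludes a positive sum when `r i` is nonnegative, decay excludes a negative sum when
-- `r j` is nonpositive; the other sign patterns reduce to these.
bounded⇒balanced : ∀ {B : Mat n n} {i j} {r : Row n} → DoubleArrow B i j → Bounded B r →
  0ℤ ≤ r i × r j ≡ - r i
bounded⇒balanced {B = B} {i} {j} {r} a bd = x≥0 , y≡-x
  where
  x≥0 : 0ℤ ≤ r i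
  x≥0 with 0ℤ ℤ.≤? r i | r j ℤ.≤? 0ℤ
  ... | yes x≥0 | _       = x≥0
  ... | no  x≱0 | yes y≤0 = ⊥-elim (bounded⇒no-decay a bd y≤0 (ℤ.+-mono-<-≤ (ℤ.≰⇒> x≱0) y≤0))
  -- Here `x < 0 < y`. One turn yields the entries `- x + 2 y` and `- y`, with positive sum `y - x`,
  -- so growth starts after that turn.
  ... | no  x≱0 | no  y≰0 = ⊥-elim (bounded⇒no-growth (turn-arrow a r)
        (bounded-ρSeq (i ∷ j ∷ []) bd) (ℤ.<⇒≤ x″>0) s″>0)
    where
    x y : ℤ
    x = r i
    y = r j
    -x>0 : 0ℤ < - x
    -x>0 = ℤ.neg-mono-< (ℤ.≰⇒> x≱0)
    y>0 : 0ℤ < y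
    y>0 = ℤ.≰⇒> y≰0
    y+0 : y + (pos x + pos x) ≡ y
    y+0 = trans (cong (λ z → y + (z + z)) (pos-≤0 (ℤ.<⇒≤ (ℤ.≰⇒> x≱0)))) (ℤ.+-identityʳ y)
    r″i : ρSeq (i ∷ j ∷ []) B r i ≡ - x + (y + y)
    r″i = trans (turn-i a r)
      (cong (λ z → - x + (z + z)) (trans (cong pos y+0) (pos-≥0 (ℤ.<⇒≤ y>0))))
    x″>0 : 0ℤ < ρSeq (i ∷ j ∷ []) B r i
    x″>0 = subst (0ℤ <_) (sym r″i) (ℤ.+-mono-< -x>0 (ℤ.+-mono-< y>0 y>0))
    s″>0 : 0ℤ < ρSeq (i ∷ j ∷ []) B r i + ρSeq (i ∷ j ∷ []) B r j
    s″>0 = subst (0ℤ <_)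
      (sym (trans (cong₂ _+_ r″i (trans (turn-j a r) (cong -_ y+0))) (lemma x y)))
      (ℤ.+-mono-< -x>0 y>0)
      where
      lemma : ∀ x y → - x + (y + y) + - y ≡ - x + y
      lemma = solve-∀
  y≡-x : r j ≡ - r i
  y≡-x with ℤ.<-cmp (r i + r j) 0ℤ
  ... | tri> _ _ s>0 = ⊥-elim (bounded⇒no-growth a bd x≥0 s>0)
  ... | tri< s<0 _ _ = ⊥-elim (bounded⇒no-decay a bd y≤0 s<0)
    where
    y≤0 : r j ≤ 0ℤ
    y≤0 = subst (_≤ 0ℤ) (lemma (r i) (r j)) (ℤ.+-mono-≤ (ℤ.<⇒≤ s<0) (ℤ.neg-mono-≤ x≥0))
      where
      lemma : ∀ x y → x + y + - x ≡ y
      lemma = solve-∀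
  ... | tri≈ _ s≡0 _ = begin
    r j                  ≡⟨ lemma (r i) (r j) ⟩
    r i + r j + - r i    ≡⟨ cong (_+ - r i) s≡0 ⟩
    0ℤ + - r i           ≡⟨ ℤ.+-identityˡ _ ⟩
    - r i                ∎
    where
    open ≡-Reasoning
    lemma : ∀ x y → y ≡ x + y + - x
    lemma = solve-∀

-- Rows of linear forms in nonnegative parameters

Form : ℕ → Set
Form = Vec ℤ

⟦_⟧ : Form m → Vec ℕ m → ℤ
⟦ [] ⟧    []      = 0ℤ
⟦ c ∷ f ⟧ (x ∷ t) = c * + x + ⟦ f ⟧ t

_⊞_ : Form m → Form m → Form m
_⊞_ = Vec.zipWith _+_

_⊡_ : ℤ → Form m → Form m
c ⊡ f = Vec.map (c *_) f

⟦⟧-⊞ : ∀ (f h : Form m) t → ⟦ f ⊞ h ⟧ t ≡ ⟦ f ⟧ t + ⟦ h ⟧ t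
⟦⟧-⊞ []      []      []      = refl
⟦⟧-⊞ (c ∷ f) (d ∷ h) (x ∷ t) rewrite ⟦⟧-⊞ f h t = lemma c d (+ x) (⟦ f ⟧ t) (⟦ h ⟧ t)
  where
  lemma : ∀ c d x u v → (c + d) * x + (u + v) ≡ c * x + u + (d * x + v)
  lemma = solve-∀

⟦⟧-⊡ : ∀ c (f : Form m) t → ⟦ c ⊡ f ⟧ t ≡ ⟦ f ⟧ t * c
⟦⟧-⊡ c []      []      = refl
⟦⟧-⊡ c (d ∷ f) (x ∷ t) rewrite ⟦⟧-⊡ c f t = lemma c d (+ x) (⟦ f ⟧ t)
  where
  lemma : ∀ c d x u → c * d * x + u * c ≡ (d * x + u) * c
  lemma = solve-∀

⟦⟧-≥0 : ∀ {f : Form m} t → All (0ℤ ≤_) f → 0ℤ ≤ ⟦ f ⟧ t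
⟦⟧-≥0 []      []         = ℤ.≤-refl
⟦⟧-≥0 (x ∷ t) (c≥0 ∷ f≥0) = ℤ.+-mono-≤ (ℤ.*-monoʳ-≤-nonNeg (+ x) c≥0) (⟦⟧-≥0 t f≥0)

⟦⟧-≤0 : ∀ {f : Form m} t → All (_≤ 0ℤ) f → ⟦ f ⟧ t ≤ 0ℤ
⟦⟧-≤0 []      []         = ℤ.≤-refl
⟦⟧-≤0 (x ∷ t) (c≤0 ∷ f≤0) = ℤ.+-mono-≤ (ℤ.*-monoʳ-≤-nonNeg (+ x) c≤0) (⟦⟧-≤0 t f≤0)

⟦⟧-0 : ∀ (f : Form m) → ⟦ f ⟧ (Vec.replicate m 0) ≡ 0ℤ
⟦⟧-0 []      = refl
⟦⟧-0 (c ∷ f) rewrite ⟦⟧-0 f = trans (ℤ.+-identityʳ _) (ℤ.*-zeroʳ c)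

-- A single positive parameter already makes the value strictly negative, the remaining terms being
-- at most zero.
⟦⟧-definite : ∀ {f : Form m} t → All (_< 0ℤ) f → 0ℤ ≤ ⟦ f ⟧ t → t ≡ Vec.replicate m 0
⟦⟧-definite []          []          _    = refl
⟦⟧-definite (zero  ∷ t) (_∷_ {x = c} _ f<0) ft≥0 =
  cong (0 ∷_) (⟦⟧-definite t f<0 (subst (0ℤ ≤_) (trans (cong (λ z → z + _) (ℤ.*-zeroʳ c)) (ℤ.+-identityˡ _)) ft≥0))
⟦⟧-definite (suc x ∷ t) (c<0 ∷ f<0) ft≥0 =
  ⊥-elim (ℤ.<⇒≱ (ℤ.+-mono-<-≤ (ℤ.*-monoʳ-<-pos +[1+ x ] c<0) (⟦⟧-≤0 t (All.map ℤ.<⇒≤ f<0))) ft≥0)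

-- An entry `nothing` stands for an arbitrary integer.
AbsRow : ℕ → ℕ → Set
AbsRow m n = Fin n → Maybe (Form m)

Models : Vec ℕ m → AbsRow m n → Row n → Set
Models t A r = ∀ j {f} → A j ≡ just f → r j ≡ ⟦ f ⟧ t

-- The weight `w` is `pos` or `neg-part` according to the sign of the entry at `k`, whose form is
-- `f`. Unknown entries away from `k` stay unknown.
absρ : (ℤ → ℤ) → Fin n → Mat n n → Form m → AbsRow m n → AbsRow m n
absρ w k B f A j =
  if does (j ≟ k) then just (-1ℤ ⊡ f) else Maybe.map (_⊞ (w (B k j) ⊡ f)) (A j)

unit : ℤ → Form (suc m)
unit c = c ∷ Vec.replicate _ 0ℤ

fresh : Fin n → ℤ → AbsRow m n → AbsRow (suc m) n
fresh k c A j = if does (j ≟ k) then just (unit c) else Maybe.map (0ℤ ∷_) (A j)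

neg-part : ℤ → ℤ
neg-part y = pos (- y)

-- The symbolic mutation sequence ks leads to a double arrow i → j.  An unknown entry is
-- split into the cases + x and − x for a fresh parameter x when it is mutated at.
Refutes : List (Fin n) → Fin n → Fin n → Mat n n → AbsRow m n → Set
RefutesAt : Maybe (Form m) → Fin n → List (Fin n) → Fin n → Fin n → Mat n n → AbsRow m n → Set

Refutes []       i j B A =
  DoubleArrow B i j × MaybeAny (All (_< 0ℤ)) (A i) × (∀ v → v ≡ j ⊎ MaybeAny (λ _ → ⊤) (A v))
Refutes (k ∷ ks) i j B A = RefutesAt (A k) k ks i j B A

RefutesAt nothing k ks i j B A =
  Refutes ks i j (μ k B) (absρ pos k B (unit 1ℤ) (fresh k 1ℤ A)) ×
  Refutes ks i j (μ k B) (absρ neg-part k B (unit -1ℤ) (fresh k -1ℤ A))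
RefutesAt (just f) k ks i j B A =
  (All (0ℤ ≤_) f × Refutes ks i j (μ k B) (absρ pos k B f A)) ⊎
  (All (_≤ 0ℤ) f × Refutes ks i j (μ k B) (absρ neg-part k B f A))

doubleArrow? : ∀ (B : Mat n n) i j → Dec (DoubleArrow B i j)
doubleArrow? B i j = map′ (λ (p , q) → p , q) (λ (p , q) → p , q)
  ((B i j ℤ.≟ + 2) ×-dec (B j i ℤ.≟ - + 2))

-- Evaluating this decision checks the whole tree of sign branches for a given sequence.
refutes? : ∀ ks i j B (A : AbsRow m n) → Dec (Refutes ks i j B A)
refutesAt? : ∀ M k ks i j B (A : AbsRow m n) → Dec (RefutesAt M k ks i j B A)

refutes? []       i j B A =
  doubleArrow? B i j ×-dec maybeAny? (All.all? (ℤ._<? 0ℤ)) (A i) ×-dec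
  all? (λ v → (v ≟ j) ⊎-dec maybeAny? (λ _ → yes tt) (A v))
refutes? (k ∷ ks) i j B A = refutesAt? (A k) k ks i j B A

refutesAt? nothing k ks i j B A =
  refutes? ks i j (μ k B) (absρ pos k B (unit 1ℤ) (fresh k 1ℤ A)) ×-dec
  refutes? ks i j (μ k B) (absρ neg-part k B (unit -1ℤ) (fresh k -1ℤ A))
refutesAt? (just f) k ks i j B A =
  (All.all? (0ℤ ℤ.≤?_) f ×-dec refutes? ks i j (μ k B) (absρ pos k B f A)) ⊎-dec
  (All.all? (ℤ._≤? 0ℤ) f ×-dec refutes? ks i j (μ k B) (absρ neg-part k B f A))

-- Balance at the double arrow from 0 to 1 gives `x` and `- x` with `x ≥ 0`.
init : AbsRow 1 (suc (suc n))
init zero          = just (1ℤ ∷ [])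
init (suc zero)    = just (-1ℤ ∷ [])
init (suc (suc _)) = nothing

⟦⟧-neg : ∀ (f : Form m) t → - ⟦ f ⟧ t ≡ ⟦ -1ℤ ⊡ f ⟧ t
⟦⟧-neg f t = sym (trans (⟦⟧-⊡ -1ℤ f t) (trans (ℤ.*-comm (⟦ f ⟧ t) -1ℤ) (ℤ.-1*i≡-i (⟦ f ⟧ t))))

⟦⟧-unit : ∀ c x (t : Vec ℕ m) → ⟦ unit c ⟧ (x ∷ t) ≡ c * + x
⟦⟧-unit c x t = trans (cong (λ z → c * + x + z) (zeros t)) (ℤ.+-identityʳ _)
  where
  zeros : ∀ {m} (t : Vec ℕ m) → ⟦ Vec.replicate m 0ℤ ⟧ t ≡ 0ℤ
  zeros []      = refl
  zeros (x ∷ t) = trans (ℤ.+-identityˡ _) (zeros t)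

-- The hypothesis on `w` is linearity of the exchange term, supplied by `exch-≥0` or `exch-≤0`; it
-- keeps known entries linear in the parameters.
models-ρ : ∀ {w k B f} {t : Vec ℕ m} {A : AbsRow m n} {r} →
  (∀ y → exch (r k) y ≡ r k * w y) → r k ≡ ⟦ f ⟧ t → Models t A r →
  Models t (absρ w k B f A) (ρ k B r)
models-ρ {w = w} {k} {B} {f} {t} {A} {r} exch≡ rk≡ mod j eq with j ≟ k
models-ρ {f = f} {t} exch≡ rk≡ mod j refl | yes refl = trans (cong -_ rk≡) (⟦⟧-neg f t)
models-ρ {w = w} {k} {B} {f} {t} {A} {r} exch≡ rk≡ mod j eq | no _ with A j in Aj
models-ρ {w = w} {k} {B} {f} {t} {A} {r} exch≡ rk≡ mod j refl | no _ | just h = begin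
  r j + exch (r k) (B k j)             ≡⟨ cong₂ _+_ (mod j Aj) (exch≡ (B k j)) ⟩
  ⟦ h ⟧ t + r k * w (B k j)            ≡⟨ cong (λ z → ⟦ h ⟧ t + z * w (B k j)) rk≡ ⟩
  ⟦ h ⟧ t + ⟦ f ⟧ t * w (B k j)        ≡⟨ cong (λ z → ⟦ h ⟧ t + z) (⟦⟧-⊡ (w (B k j)) f t) ⟨
  ⟦ h ⟧ t + ⟦ w (B k j) ⊡ f ⟧ t        ≡⟨ ⟦⟧-⊞ h (w (B k j) ⊡ f) t ⟨
  ⟦ h ⊞ (w (B k j) ⊡ f) ⟧ t            ∎
  where open ≡-Reasoning

models-fresh : ∀ {k c x} {t : Vec ℕ m} {A : AbsRow m n} {r} →
  r k ≡ c * + x → Models t A r → Models (x ∷ t) (fresh k c A) r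
models-fresh {k = k} {A = A} rk≡ mod j eq with j ≟ k
models-fresh {c = c} {x} {t} rk≡ mod j refl | yes refl = trans rk≡ (sym (⟦⟧-unit c x t))
models-fresh {A = A} rk≡ mod j eq | no _ with A j in Aj
models-fresh {A = A} rk≡ mod j refl | no _ | just h = trans (mod j Aj) (sym (ℤ.+-identityˡ _))

-- At the final double arrow balance gives `r i ≥ 0`, while its form has only negative coefficients,
-- so all parameters vanish. Then the known entries vanish, and so does entry `j`, which is `- r i`;
-- `ρ-zero` carries this back.
refutes-sound : ∀ ks {i j B} {t : Vec ℕ m} {A : AbsRow m n} {r} →
  Refutes ks i j B A → Models t A r → Bounded B r → ∀ v → r v ≡ 0ℤ
refutes-sound {m} [] {i} {j} {B} {t} {A} {r} (arrow , neg , known) mod bd v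
  with A i in Ai
... | just f with neg
...   | just f<0 = vanish (known v)
  where
  t≡0 : t ≡ Vec.replicate m 0
  t≡0 = ⟦⟧-definite t f<0 (subst (0ℤ ≤_) (mod i Ai) (proj₁ (bounded⇒balanced arrow bd)))
  form≡0 : ∀ h → ⟦ h ⟧ t ≡ 0ℤ
  form≡0 h = trans (cong ⟦ h ⟧ t≡0) (⟦⟧-0 h)
  vanish : v ≡ j ⊎ MaybeAny (λ _ → ⊤) (A v) → r v ≡ 0ℤ
  vanish (inj₁ refl) =
    trans (proj₂ (bounded⇒balanced arrow bd)) (cong -_ (trans (mod i Ai) (form≡0 f)))
  vanish (inj₂ _) with A v in Av
  vanish (inj₂ _)  | just h = trans (mod v Av) (form≡0 h)
  vanish (inj₂ ()) | nothing
refutes-sound (k ∷ ks) {B = B} {t} {A} {r} ref mod bd with A k in Ak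
refutes-sound (k ∷ ks) {B = B} {t} {A} {r} (inj₁ (f≥0 , ref)) mod bd | just f =
  ρ-zero k B r (refutes-sound ks ref
    (models-ρ {B = B} (λ y → exch-≥0 y rk≥0) (mod k Ak) mod) (bounded-ρ k bd))
  where
  rk≥0 : 0ℤ ≤ r k
  rk≥0 = subst (0ℤ ≤_) (sym (mod k Ak)) (⟦⟧-≥0 t f≥0)
refutes-sound (k ∷ ks) {B = B} {t} {A} {r} (inj₂ (f≤0 , ref)) mod bd | just f =
  ρ-zero k B r (refutes-sound ks ref
    (models-ρ {B = B} (λ y → exch-≤0 y rk≤0) (mod k Ak) mod) (bounded-ρ k bd))
  where
  rk≤0 : r k ≤ 0ℤ
  rk≤0 = subst (_≤ 0ℤ) (sym (mod k Ak)) (⟦⟧-≤0 t f≤0)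
-- In either sign branch the fresh parameter takes the value `∣ r k ∣`.
refutes-sound (k ∷ ks) {B = B} {t} {A} {r} (ref₊ , ref₋) mod bd | nothing with ℤ.≤-total 0ℤ (r k)
... | inj₁ rk≥0 = ρ-zero k B r (refutes-sound ks ref₊
      (models-ρ {B = B} (λ y → exch-≥0 y rk≥0) (trans rk≡ (sym (⟦⟧-unit 1ℤ _ t))) (models-fresh {c = 1ℤ} rk≡ mod))
      (bounded-ρ k bd))
  where
  rk≡ : r k ≡ 1ℤ * + ∣ r k ∣
  rk≡ = sym (trans (ℤ.*-identityˡ _) (ℤ.0≤i⇒+∣i∣≡i rk≥0))
... | inj₂ rk≤0 = ρ-zero k B r (refutes-sound ks ref₋
      (models-ρ {B = B} (λ y → exch-≤0 y rk≤0) (trans rk≡ (sym (⟦⟧-unit -1ℤ _ t))) (models-fresh {c = -1ℤ} rk≡ mod))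
      (bounded-ρ k bd))
  where
  rk≡ : r k ≡ -1ℤ * + ∣ r k ∣
  rk≡ = sym (begin
    -1ℤ * + ∣ r k ∣     ≡⟨ ℤ.-1*i≡-i _ ⟩
    - + ∣ r k ∣         ≡⟨ cong (-_ ∘ +_) (ℤ.∣-i∣≡∣i∣ (r k)) ⟨
    - + ∣ - r k ∣       ≡⟨ cong -_ (ℤ.0≤i⇒+∣i∣≡i (ℤ.neg-mono-≤ rk≤0)) ⟩
    - - r k             ≡⟨ ℤ.neg-involutive (r k) ⟩
    r k                 ∎)
    where open ≡-Reasoning

bounded⇒zero : ∀ ks {i j} {B : Mat (suc (suc n)) (suc (suc n))} {r} →
  DoubleArrow B zero (suc zero) → True (refutes? ks i j B init) →
  Bounded B r → ∀ v → r v ≡ 0ℤ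
bounded⇒zero ks {r = r} arrow ok bd = refutes-sound ks {t = ∣ r zero ∣ ∷ []} (toWitness ok) mod bd
  where
  r₀ : r zero ≡ 1ℤ * + ∣ r zero ∣ + 0ℤ
  r₀ = sym (trans (ℤ.+-identityʳ _) (trans (ℤ.*-identityˡ _) (ℤ.0≤i⇒+∣i∣≡i (proj₁ (bounded⇒balanced arrow bd)))))
  mod : Models (∣ r zero ∣ ∷ []) init r
  mod zero       refl = r₀
  mod (suc zero) refl = trans (proj₂ (bounded⇒balanced arrow bd))
    (trans (cong -_ r₀) (lemma (+ ∣ r zero ∣)))
    where
    lemma : ∀ z → - (1ℤ * z + 0ℤ) ≡ -1ℤ * z + 0ℤ
    lemma z = trans (cong -_ (trans (ℤ.+-identityʳ _) (ℤ.*-identityˡ z))) (sym (trans (ℤ.+-identityʳ _) (ℤ.-1*i≡-i z)))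

-- Diagonal conjugation, through signed squares

φ : ℤ → ℤ
φ x = x * + ∣ x ∣

φ-* : ∀ x y → φ (x * y) ≡ φ x * φ y
φ-* x y = begin
  x * y * + ∣ x * y ∣               ≡⟨ cong (λ z → x * y * + z) (ℤ.abs-* x y) ⟩
  x * y * + (∣ x ∣ ℕ.* ∣ y ∣)       ≡⟨ cong (λ z → x * y * z) (ℤ.pos-* ∣ x ∣ ∣ y ∣) ⟩
  x * y * (+ ∣ x ∣ * + ∣ y ∣)       ≡⟨ lemma x y (+ ∣ x ∣) (+ ∣ y ∣) ⟩
  φ x * φ y                         ∎
  where
  open ≡-Reasoning
  lemma : ∀ x y u v → x * y * (u * v) ≡ x * u * (y * v)
  lemma = solve-∀

φ-neg : ∀ x → φ (- x) ≡ - φ x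
φ-neg x = trans (cong (λ z → - x * + z) (ℤ.∣-i∣≡∣i∣ x)) (sym (ℤ.neg-distribˡ-* x _))

∣φ∣ : ∀ x → ∣ φ x ∣ ≡ ∣ x ∣ ℕ.* ∣ x ∣
∣φ∣ x = ℤ.abs-* x (+ ∣ x ∣)

-- a √p = c √q; the signed square φ is injective and multiplicative, so it keeps this
-- relation between real multiples inside ℤ.
record Rel (p q : ℕ) (a c : ℤ) : Set where
  constructor ⟨_⟩
  field
    φ-eq : φ c * + q ≡ φ a * + p
open Rel

data SameSign : ℤ → ℤ → Set where
  both-0 : SameSign 0ℤ 0ℤ
  both-+ : ∀ {a c} → SameSign +[1+ a ] +[1+ c ]
  both-- : ∀ {a c} → SameSign -[1+ a ] -[1+ c ]

rel⇒sameSign : ∀ {p q} .{{_ : NonZero p}} .{{_ : NonZero q}} a c → Rel p q a c → SameSign a c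
rel⇒sameSign {suc p} {suc q} (+ zero) (+ zero) _ = both-0
rel⇒sameSign {suc p} {suc q} (+ zero) +[1+ c ] ⟨ () ⟩
rel⇒sameSign {suc p} {suc q} (+ zero) -[1+ c ] ⟨ () ⟩
rel⇒sameSign {suc p} {suc q} +[1+ a ] (+ zero) ⟨ () ⟩
rel⇒sameSign {suc p} {suc q} +[1+ a ] +[1+ c ] _ = both-+
rel⇒sameSign {suc p} {suc q} +[1+ a ] -[1+ c ] ⟨ () ⟩
rel⇒sameSign {suc p} {suc q} -[1+ a ] (+ zero) ⟨ () ⟩
rel⇒sameSign {suc p} {suc q} -[1+ a ] +[1+ c ] ⟨ () ⟩
rel⇒sameSign {suc p} {suc q} -[1+ a ] -[1+ c ] _ = both--

square-injective : ∀ {a b} → a ℕ.* a ≡ b ℕ.* b → a ≡ b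
square-injective {a} {b} eq with ℕ.<-cmp a b
... | tri< a<b _ _ = ⊥-elim (ℕ.<⇒≢ (ℕ.*-mono-< a<b a<b) eq)
... | tri≈ _ a≡b _ = a≡b
... | tri> _ _ a>b = ⊥-elim (ℕ.<⇒≢ (ℕ.*-mono-< a>b a>b) (sym eq))

φ-injective : ∀ {a b} → φ a ≡ φ b → a ≡ b
φ-injective {a} {b} eq with rel⇒sameSign {1} {1} a b ⟨ cong (_* + 1) (sym eq) ⟩
... | both-0 = refl
... | both-+ = cong +_ (square-injective (cong ∣_∣ eq))
... | both-- = cong -[1+_] (ℕ.suc-injective (square-injective (cong ∣_∣ eq)))

rel-neg : ∀ {p q a c} → Rel p q a c → Rel p q (- a) (- c)
rel-neg {p} {q} {a} {c} rel = ⟨ (begin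
  φ (- c) * + q    ≡⟨ cong (_* + q) (φ-neg c) ⟩
  - φ c * + q      ≡⟨ ℤ.neg-distribˡ-* (φ c) (+ q) ⟨
  - (φ c * + q)    ≡⟨ cong -_ (rel .φ-eq) ⟩
  - (φ a * + p)    ≡⟨ ℤ.neg-distribˡ-* (φ a) (+ p) ⟩
  - φ a * + p      ≡⟨ cong (_* + p) (φ-neg a) ⟨
  φ (- a) * + p    ∎) ⟩
  where open ≡-Reasoning

-- The middle weight `s` cancels, so a product along a path through `k` scales like a direct entry;
-- exchange terms need exactly this.
rel-* : ∀ {p s q a c a′ c′} → Rel p s a c → Rel s q a′ c′ → Rel p q (a * a′) (c * c′)
rel-* {p} {s} {q} {a} {c} {a′} {c′} rel rel′ = ⟨ (begin
  φ (c * c′) * + q         ≡⟨ cong (_* + q) (φ-* c c′) ⟩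
  φ c * φ c′ * + q         ≡⟨ ℤ.*-assoc (φ c) (φ c′) (+ q) ⟩
  φ c * (φ c′ * + q)       ≡⟨ cong (φ c *_) (rel′ .φ-eq) ⟩
  φ c * (φ a′ * + s)       ≡⟨ lemma (φ c) (φ a′) (+ s) ⟩
  φ c * + s * φ a′         ≡⟨ cong (_* φ a′) (rel .φ-eq) ⟩
  φ a * + p * φ a′         ≡⟨ lemma′ (φ a) (+ p) (φ a′) ⟩
  φ a * φ a′ * + p         ≡⟨ cong (_* + p) (φ-* a a′) ⟨
  φ (a * a′) * + p         ∎) ⟩
  where
  open ≡-Reasoning
  lemma : ∀ x y z → x * (y * z) ≡ x * z * y
  lemma = solve-∀
  lemma′ : ∀ x y z → x * y * z ≡ x * z * y
  lemma′ = solve-∀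

rel-exch : ∀ {p s q a c a′ c′} .{{_ : NonZero p}} .{{_ : NonZero s}} .{{_ : NonZero q}} →
  Rel p s a c → Rel s q a′ c′ → Rel p q (exch a a′) (exch c c′)
rel-exch {a = a} {c} {a′} {c′} rel rel′
  with rel⇒sameSign a c rel | rel⇒sameSign a′ c′ rel′
... | both-0 | _      = ⟨ refl ⟩
... | both-+ | both-0 = ⟨ refl ⟩
... | both-+ | both-+ = rel-* rel rel′
... | both-+ | both-- = ⟨ refl ⟩
... | both-- | both-0 = ⟨ refl ⟩
... | both-- | both-+ = ⟨ refl ⟩
... | both-- | both-- = rel-neg (rel-* rel rel′)

-- Both pairs satisfy `a √p = c √q`, hence are proportional; injectivity of `φ` removes the squares.
rel-cross : ∀ {p q a c a′ c′} .{{_ : NonZero q}} →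
  Rel p q a c → Rel p q a′ c′ → a * c′ ≡ a′ * c
rel-cross {p} {suc q} {a} {c} {a′} {c′} rel rel′ =
  φ-injective (ℤ.*-cancelʳ-≡ _ _ (+ suc q) (begin
    φ (a * c′) * + suc q       ≡⟨ cong (_* + suc q) (φ-* a c′) ⟩
    φ a * φ c′ * + suc q       ≡⟨ ℤ.*-assoc (φ a) (φ c′) (+ suc q) ⟩
    φ a * (φ c′ * + suc q)     ≡⟨ cong (φ a *_) (rel′ .φ-eq) ⟩
    φ a * (φ a′ * + p)         ≡⟨ lemma (φ a) (φ a′) (+ p) ⟩
    φ a′ * (φ a * + p)         ≡⟨ cong (φ a′ *_) (rel .φ-eq) ⟨
    φ a′ * (φ c * + suc q)     ≡⟨ ℤ.*-assoc (φ a′) (φ c) (+ suc q) ⟨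
    φ a′ * φ c * + suc q       ≡⟨ cong (_* + suc q) (φ-* a′ c) ⟨
    φ (a′ * c) * + suc q       ∎))
  where
  open ≡-Reasoning
  lemma : ∀ x y z → x * (y * z) ≡ y * (x * z)
  lemma = solve-∀

-- By rel-cross both pairs have the same ratio, so (a + a′) / (c + c′) = a / c.
rel-+-≢0 : ∀ {p q a c a′ c′} .{{_ : NonZero q}} .{{_ : ℤ.NonZero (φ c)}} →
  Rel p q a c → Rel p q a′ c′ → Rel p q (a + a′) (c + c′)
rel-+-≢0 {p} {q} {a} {c} {a′} {c′} rel rel′ =
  ⟨ ℤ.*-cancelʳ-≡ _ _ (φ c) (begin
    φ (c + c′) * + q * φ c          ≡⟨ lemma (φ (c + c′)) (+ q) (φ c) ⟩
    φ (c + c′) * (φ c * + q)        ≡⟨ cong (φ (c + c′) *_) (rel .φ-eq) ⟩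
    φ (c + c′) * (φ a * + p)        ≡⟨ lemma′ (φ (c + c′)) (φ a) (+ p) ⟩
    φ a * φ (c + c′) * + p          ≡⟨ cong (_* + p) (φ-* a (c + c′)) ⟨
    φ (a * (c + c′)) * + p          ≡⟨ cong (λ z → φ z * + p) cross ⟩
    φ ((a + a′) * c) * + p          ≡⟨ cong (_* + p) (φ-* (a + a′) c) ⟩
    φ (a + a′) * φ c * + p          ≡⟨ lemma″ (φ (a + a′)) (φ c) (+ p) ⟩
    φ (a + a′) * + p * φ c          ∎) ⟩
  where
  open ≡-Reasoning
  lemma : ∀ x y z → x * y * z ≡ x * (z * y)
  lemma = solve-∀
  lemma′ : ∀ x y z → x * (y * z) ≡ y * x * z
  lemma′ = solve-∀
  lemma″ : ∀ x y z → x * y * z ≡ x * z * y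
  lemma″ = solve-∀
  cross : a * (c + c′) ≡ (a + a′) * c
  cross = begin
    a * (c + c′)      ≡⟨ ℤ.*-distribˡ-+ a c c′ ⟩
    a * c + a * c′    ≡⟨ cong (λ z → a * c + z) (rel-cross rel rel′) ⟩
    a * c + a′ * c    ≡⟨ ℤ.*-distribʳ-+ c a a′ ⟨
    (a + a′) * c      ∎

-- As `φ` is not additive, the common ratio is used when the first pair is nonzero; a zero first
-- pair leaves the second one unchanged.
rel-+ : ∀ {p q a c a′ c′} .{{_ : NonZero p}} .{{_ : NonZero q}} →
  Rel p q a c → Rel p q a′ c′ → Rel p q (a + a′) (c + c′)
rel-+ {p} {q} {a} {c} {a′} {c′} rel rel′ with rel⇒sameSign a c rel
... | both-0 rewrite ℤ.+-identityˡ a′ | ℤ.+-identityˡ c′ = rel′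
... | both-+ = rel-+-≢0 rel rel′
... | both-- = rel-+-≢0 rel rel′

rel⇒squares : ∀ {p q a c} → Rel p q a c → ∣ c ∣ ℕ.* ∣ c ∣ ℕ.* q ≡ ∣ a ∣ ℕ.* ∣ a ∣ ℕ.* p
rel⇒squares {p} {q} {a} {c} rel = begin
  ∣ c ∣ ℕ.* ∣ c ∣ ℕ.* q    ≡⟨ cong (ℕ._* q) (∣φ∣ c) ⟨
  ∣ φ c ∣ ℕ.* q            ≡⟨ ℤ.abs-* (φ c) (+ q) ⟨
  ∣ φ c * + q ∣            ≡⟨ cong ∣_∣ (rel .φ-eq) ⟩
  ∣ φ a * + p ∣            ≡⟨ ℤ.abs-* (φ a) (+ p) ⟩
  ∣ φ a ∣ ℕ.* p            ≡⟨ cong (ℕ._* p) (∣φ∣ a) ⟩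
  ∣ a ∣ ℕ.* ∣ a ∣ ℕ.* p    ∎
  where open ≡-Reasoning

-- Mutation under relabelling and diagonal conjugation.

module Rescaling (σ : Permutation′ n) (q : Fin n → ℕ) {{q≢0 : ∀ {i} → NonZero (q i)}} where

  s : Fin n → Fin n
  s = σ ⟨$⟩ʳ_

  s-injective : ∀ {i j} → s i ≡ s j → i ≡ j
  s-injective eq = trans (sym (inverseˡ σ)) (trans (cong (σ ⟨$⟩ˡ_) eq) (inverseˡ σ))

  -- With `D` the diagonal matrix of the square roots of `q`, this says that `B₂`, relabelled by
  -- `σ`, is `D B₁ D⁻¹`.
  record Scaling (B₁ B₂ : Mat n n) : Set where
    constructor scaling
    field
      at : ∀ i j → Rel (q i) (q j) (B₁ i j) (B₂ (s i) (s j))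
  open Scaling public

  record RowScaling (p : ℕ) (r₁ r₂ : Row n) : Set where
    constructor rowScaling
    field
      at : ∀ j → Rel p (q j) (r₁ j) (r₂ (s j))
  open RowScaling public

  -- A positive diagonal preserves signs, and its factor at `k` cancels in each exchange term.
  scaling-μ : ∀ {B₁ B₂} k → Scaling B₁ B₂ → Scaling (μ k B₁) (μ (s k) B₂)
  scaling-μ {B₁} {B₂} k S .at i j with position k i j
  ... | in-row =
    subst₂ (Rel _ _) (sym (μ-row B₁)) (sym (μ-row B₂)) (rel-neg (S .at k j))
  ... | in-col =
    subst₂ (Rel _ _) (sym (μ-col B₁)) (sym (μ-col B₂)) (rel-neg (S .at i k))
  ... | off i≢k j≢k =
    subst₂ (Rel _ _) (sym (μ-off B₁ i≢k j≢k))
      (sym (μ-off B₂ (i≢k ∘ s-injective) (j≢k ∘ s-injective)))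
      (rel-+ (S .at i j)
        (rel-exch (S .at i k) (S .at k j)))

  rowScaling-ρ : ∀ {p B₁ B₂ r₁ r₂} .{{_ : NonZero p}} k → Scaling B₁ B₂ →
    RowScaling p r₁ r₂ → RowScaling p (ρ k B₁ r₁) (ρ (s k) B₂ r₂)
  rowScaling-ρ {p} {B₁} {B₂} {r₁} {r₂} k S R .at j with j ≟ k
  ... | yes refl = subst (Rel p _ (- r₁ k)) (sym (ρ-at (s k) B₂ r₂))
    (rel-neg (R .at k))
  ... | no j≢k = subst (Rel p _ (r₁ j + exch (r₁ k) (B₁ k j)))
    (sym (ρ-off B₂ r₂ (j≢k ∘ s-injective)))
    (rel-+ (R .at j)
      (rel-exch (R .at k) (S .at k j)))

  rowScaling-ρSeq : ∀ {p B₁ B₂ r₁ r₂} .{{_ : NonZero p}} ks → Scaling B₁ B₂ →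
    RowScaling p r₁ r₂ → RowScaling p (ρSeq ks B₁ r₁) (ρSeq (map s ks) B₂ r₂)
  rowScaling-ρSeq []       S R = R
  rowScaling-ρSeq (k ∷ ks) S R = rowScaling-ρSeq ks (scaling-μ k S) (rowScaling-ρ k S R)

  -- Mutation being an involution, `ks` is undone by mutating `B₂` at the relabelled vertices in
  -- reverse order.
  scaling-unmutate : ∀ ks {B₁ B₂} → Scaling (mutSeq μ ks B₁) B₂ →
    ∃[ ls ] Scaling B₁ (mutSeq μ ls B₂)
  scaling-unmutate []       S = [] , S
  scaling-unmutate (k ∷ ks) {B₁} {B₂} S with ls , S′ ← scaling-unmutate ks S =
    ls ++ s k ∷ [] , scaling λ i j → subst₂ (Rel (q i) (q j)) (μ-involutive k B₁ i j)
      (cong (λ B → B (s i) (s j)) (sym (mutSeq-∷ʳ ls (s k) B₂)))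
      (scaling-μ k S′ .at i j)

  -- A natural number is at most its square, so the bound is read off the squared relation.
  bounded-scaling : ∀ {p B₁ B₂ r₁ r₂} .{{_ : NonZero p}} → Scaling B₁ B₂ →
    RowScaling p r₁ r₂ → Bounded B₂ r₂ → Bounded B₁ r₁
  bounded-scaling {p} {B₁} {B₂} {r₁} {r₂} S R (N , bnd) =
    (λ j → N (s j) ℕ.* N (s j) ℕ.* q j) , λ ks j →
      let a = ρSeq ks B₁ r₁ j
          c = ρSeq (map s ks) B₂ r₂ (s j)
      in begin
        ∣ a ∣                         ≤⟨ ≤-square ∣ a ∣ ⟩
        ∣ a ∣ ℕ.* ∣ a ∣               ≤⟨ ℕ.m≤m*n _ p ⟩
        ∣ a ∣ ℕ.* ∣ a ∣ ℕ.* p         ≡⟨ rel⇒squares (rowScaling-ρSeq ks S R .at j) ⟨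
        ∣ c ∣ ℕ.* ∣ c ∣ ℕ.* q j       ≤⟨ ℕ.*-monoˡ-≤ (q j) (ℕ.*-mono-≤ (bnd (map s ks) (s j)) (bnd (map s ks) (s j))) ⟩
        N (s j) ℕ.* N (s j) ℕ.* q j   ∎
    where
    open ℕ.≤-Reasoning
    ≤-square : ∀ m → m ℕ.≤ m ℕ.* m
    ≤-square zero    = z≤n
    ≤-square (suc m) = ℕ.m≤m*n (suc m) (suc m)

-- Matrices with the same diagram

data Opposite : ℤ → ℤ → Set where
  zero-zero : Opposite 0ℤ 0ℤ
  pos-neg   : ∀ {a b} → Opposite +[1+ a ] -[1+ b ]
  neg-pos   : ∀ {a b} → Opposite -[1+ a ] +[1+ b ]

opposite : ∀ {p q} .{{_ : NonZero p}} .{{_ : NonZero q}} x y →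
  x * + p ≡ - (y * + q) → Opposite x y
opposite {suc p} {suc q} (+ zero) (+ zero) _ = zero-zero
opposite {suc p} {suc q} (+ zero) +[1+ y ] ()
opposite {suc p} {suc q} (+ zero) -[1+ y ] ()
opposite {suc p} {suc q} +[1+ x ] (+ zero) ()
opposite {suc p} {suc q} +[1+ x ] +[1+ y ] ()
opposite {suc p} {suc q} +[1+ x ] -[1+ y ] _ = pos-neg
opposite {suc p} {suc q} -[1+ x ] (+ zero) ()
opposite {suc p} {suc q} -[1+ x ] +[1+ y ] _ = neg-pos
opposite {suc p} {suc q} -[1+ x ] -[1+ y ] ()

opposite⇒abs : ∀ {p q} x y → x * + p ≡ - (y * + q) → ∣ x ∣ ℕ.* p ≡ ∣ y ∣ ℕ.* q
opposite⇒abs {p} {q} x y eq = begin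
  ∣ x ∣ ℕ.* p         ≡⟨ ℤ.abs-* x (+ p) ⟨
  ∣ x * + p ∣         ≡⟨ cong ∣_∣ eq ⟩
  ∣ - (y * + q) ∣     ≡⟨ ℤ.∣-i∣≡∣i∣ (y * + q) ⟩
  ∣ y * + q ∣         ≡⟨ ℤ.abs-* y (+ q) ⟩
  ∣ y ∣ ℕ.* q         ∎
  where open ≡-Reasoning

-- The mirror image of SkewSymmetrizable: e is a multiple of 1 / d for a symmetrizer d.
LeftSkew : (Fin n → ℕ) → Mat n n → Set
LeftSkew e B = ∀ i j → B i j * + e i ≡ - (B j i * + e j)

skew-* : ∀ {p s q} a a′ b b′ → a * + p ≡ - (a′ * + s) → b * + s ≡ - (b′ * + q) →
  a * b * + p ≡ b′ * a′ * + q
skew-* {p} {s} {q} a a′ b b′ aeq beq = begin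
  a * b * + p            ≡⟨ lemma₁ a b (+ p) ⟩
  a * + p * b            ≡⟨ cong (_* b) aeq ⟩
  - (a′ * + s) * b       ≡⟨ lemma₂ a′ (+ s) b ⟩
  - (b * + s) * a′       ≡⟨ cong (λ z → - z * a′) beq ⟩
  - - (b′ * + q) * a′    ≡⟨ lemma₃ b′ (+ q) a′ ⟩
  b′ * a′ * + q          ∎
  where
  open ≡-Reasoning
  lemma₁ : ∀ x y z → x * y * z ≡ x * z * y
  lemma₁ = solve-∀
  lemma₂ : ∀ x y z → - (x * y) * z ≡ - (z * y) * x
  lemma₂ = solve-∀
  lemma₃ : ∀ x y z → - - (x * y) * z ≡ x * z * y
  lemma₃ = solve-∀

exch-skew : ∀ {p s q} .{{_ : NonZero p}} .{{_ : NonZero s}} .{{_ : NonZero q}} a a′ b b′ →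
  a * + p ≡ - (a′ * + s) → b * + s ≡ - (b′ * + q) → exch a b * + p ≡ - (exch b′ a′ * + q)
exch-skew {p} {s} {q} a a′ b b′ aeq beq with opposite a a′ aeq | opposite b b′ beq
... | zero-zero | zero-zero = refl
... | zero-zero | pos-neg   = refl
... | zero-zero | neg-pos   = refl
... | pos-neg   | zero-zero = refl
... | pos-neg   | neg-pos   = refl
... | neg-pos   | zero-zero = refl
... | neg-pos   | pos-neg   = refl
-- Multiplying two skew relations gives a plus sign; the minus returns because `b′` and `a′` are
-- both negative, where `exch` negates the product.
... | pos-neg   | pos-neg   = trans (skew-* a a′ b b′ aeq beq) (lemma (b′ * a′) (+ q))
  where
  lemma : ∀ x y → x * y ≡ - (- x * y)
  lemma = solve-∀
... | neg-pos   | neg-pos   =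
  trans (sym (ℤ.neg-distribˡ-* (a * b) (+ p))) (cong -_ (skew-* a a′ b b′ aeq beq))

neg-skew : ∀ a b x y → a * x ≡ - (b * y) → - a * x ≡ - (- b * y)
neg-skew a b x y eq =
  trans (sym (ℤ.neg-distribˡ-* a x)) (cong -_ (trans eq (ℤ.neg-distribˡ-* b y)))

module _ {e : Fin n → ℕ} {{e≢0 : ∀ {i} → NonZero (e i)}} where

  leftSkew-μ : ∀ {B} k → LeftSkew e B → LeftSkew e (μ k B)
  leftSkew-μ {B} k skew i j with position k i j
  ... | in-row = begin
    μ k B k j * + e k      ≡⟨ cong (_* + e k) (μ-row B) ⟩
    - B k j * + e k        ≡⟨ neg-skew (B k j) (B j k) (+ e k) (+ e j) (skew k j) ⟩
    - (- B j k * + e j)    ≡⟨ cong (λ z → - (z * + e j)) (μ-col B) ⟨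
    - (μ k B j k * + e j)  ∎
    where open ≡-Reasoning
  ... | in-col = begin
    μ k B i k * + e i      ≡⟨ cong (_* + e i) (μ-col B) ⟩
    - B i k * + e i        ≡⟨ neg-skew (B i k) (B k i) (+ e i) (+ e k) (skew i k) ⟩
    - (- B k i * + e k)    ≡⟨ cong (λ z → - (z * + e k)) (μ-row B) ⟨
    - (μ k B k i * + e k)  ∎
    where open ≡-Reasoning
  ... | off i≢k j≢k = begin
    μ k B i j * + e i
      ≡⟨ cong (_* + e i) (μ-off B i≢k j≢k) ⟩
    (B i j + exch (B i k) (B k j)) * + e i
      ≡⟨ ℤ.*-distribʳ-+ (+ e i) (B i j) _ ⟩
    B i j * + e i + exch (B i k) (B k j) * + e i
      ≡⟨ cong₂ _+_ (skew i j) (exch-skew (B i k) (B k i) (B k j) (B j k) (skew i k) (skew k j)) ⟩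
    - (B j i * + e j) + - (exch (B j k) (B k i) * + e j)
      ≡⟨ lemma (B j i) (exch (B j k) (B k i)) (+ e j) ⟩
    - ((B j i + exch (B j k) (B k i)) * + e j)
      ≡⟨ cong (λ z → - (z * + e j)) (μ-off B j≢k i≢k) ⟨
    - (μ k B j i * + e j)
      ∎
    where
    open ≡-Reasoning
    lemma : ∀ x y z → - (x * z) + - (y * z) ≡ - ((x + y) * z)
    lemma = solve-∀

  leftSkew-mutSeq : ∀ ks {B} → LeftSkew e B → LeftSkew e (mutSeq μ ks B)
  leftSkew-mutSeq []       skew = skew
  leftSkew-mutSeq (k ∷ ks) skew = leftSkew-mutSeq ks (leftSkew-μ k skew)

-- Isolates the dependence of `diagram` on a pair of opposite entries, so a diagram isomorphism is
-- definitionally an equality of these weights.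
arrowWeight : ℤ → ℤ → ℕ
arrowWeight x y = if does (0ℤ <? x) then ∣ x * y ∣ else 0

sameWeight⇒squares : ∀ u v u′ v′ dᵢ dⱼ eᵢ eⱼ →
  u ℕ.* eᵢ ≡ v ℕ.* eⱼ → u′ ℕ.* dⱼ ≡ v′ ℕ.* dᵢ → u ℕ.* v ≡ u′ ℕ.* v′ →
  u′ ℕ.* u′ ℕ.* (dⱼ ℕ.* eⱼ) ≡ u ℕ.* u ℕ.* (dᵢ ℕ.* eᵢ)
sameWeight⇒squares u v u′ v′ dᵢ dⱼ eᵢ eⱼ ue u′d uv = begin
  u′ ℕ.* u′ ℕ.* (dⱼ ℕ.* eⱼ)      ≡⟨ lemma₁ u′ dⱼ eⱼ ⟩
  u′ ℕ.* (u′ ℕ.* dⱼ) ℕ.* eⱼ      ≡⟨ cong (λ z → u′ ℕ.* z ℕ.* eⱼ) u′d ⟩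
  u′ ℕ.* (v′ ℕ.* dᵢ) ℕ.* eⱼ      ≡⟨ lemma₂ u′ v′ dᵢ eⱼ ⟩
  u′ ℕ.* v′ ℕ.* (dᵢ ℕ.* eⱼ)      ≡⟨ cong (ℕ._* (dᵢ ℕ.* eⱼ)) uv ⟨
  u ℕ.* v ℕ.* (dᵢ ℕ.* eⱼ)        ≡⟨ lemma₃ u v dᵢ eⱼ ⟩
  u ℕ.* (v ℕ.* eⱼ) ℕ.* dᵢ        ≡⟨ cong (λ z → u ℕ.* z ℕ.* dᵢ) ue ⟨
  u ℕ.* (u ℕ.* eᵢ) ℕ.* dᵢ        ≡⟨ lemma₄ u eᵢ dᵢ ⟩
  u ℕ.* u ℕ.* (dᵢ ℕ.* eᵢ)        ∎
  where
  open ≡-Reasoning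
  lemma₁ : ∀ a b c → a ℕ.* a ℕ.* (b ℕ.* c) ≡ a ℕ.* (a ℕ.* b) ℕ.* c
  lemma₁ = ℕ-Solver.solve-∀
  lemma₂ : ∀ a b c d → a ℕ.* (b ℕ.* c) ℕ.* d ≡ a ℕ.* b ℕ.* (c ℕ.* d)
  lemma₂ = ℕ-Solver.solve-∀
  lemma₃ : ∀ a b c d → a ℕ.* b ℕ.* (c ℕ.* d) ≡ a ℕ.* (b ℕ.* d) ℕ.* c
  lemma₃ = ℕ-Solver.solve-∀
  lemma₄ : ∀ a b c → a ℕ.* (a ℕ.* b) ℕ.* c ≡ a ℕ.* a ℕ.* (c ℕ.* b)
  lemma₄ = ℕ-Solver.solve-∀

squares⇒rel : ∀ {p q a c} → SameSign a c →
  ∣ c ∣ ℕ.* ∣ c ∣ ℕ.* q ≡ ∣ a ∣ ℕ.* ∣ a ∣ ℕ.* p → Rel p q a c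
squares⇒rel both-0 _ = ⟨ refl ⟩
squares⇒rel {p} {q} (both-+ {a} {c}) eq = ⟨ trans (sym (ℤ.pos-* (suc c ℕ.* suc c) q))
  (trans (cong +_ eq) (ℤ.pos-* (suc a ℕ.* suc a) p)) ⟩
squares⇒rel (both-- {a} {c}) eq = rel-neg (squares⇒rel (both-+ {a} {c}) eq)

-- The directions of the arrows fix the signs. Each symmetrizer expresses an entry's partner through
-- the entry, so equal weights compare squares.
sameWeight⇒rel : ∀ {dᵢ dⱼ eᵢ eⱼ} .{{_ : NonZero dᵢ}} .{{_ : NonZero dⱼ}}
  .{{_ : NonZero eᵢ}} .{{_ : NonZero eⱼ}} a a′ c c′ →
  a * + eᵢ ≡ - (a′ * + eⱼ) → c * + dⱼ ≡ - (c′ * + dᵢ) →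
  arrowWeight a a′ ≡ arrowWeight c c′ → arrowWeight a′ a ≡ arrowWeight c′ c →
  Rel (dᵢ ℕ.* eᵢ) (dⱼ ℕ.* eⱼ) a c
sameWeight⇒rel a a′ c c′ aeq ceq w w′ with opposite a a′ aeq | opposite c c′ ceq
sameWeight⇒rel a a′ c c′ aeq ceq w  w′ | zero-zero | zero-zero = ⟨ refl ⟩
sameWeight⇒rel a a′ c c′ aeq ceq () w′ | zero-zero | pos-neg
sameWeight⇒rel a a′ c c′ aeq ceq w  () | zero-zero | neg-pos
sameWeight⇒rel a a′ c c′ aeq ceq () w′ | pos-neg   | zero-zero
sameWeight⇒rel a a′ c c′ aeq ceq () w′ | pos-neg   | neg-pos
sameWeight⇒rel a a′ c c′ aeq ceq w  () | neg-pos   | zero-zero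
sameWeight⇒rel a a′ c c′ aeq ceq () w′ | neg-pos   | pos-neg
sameWeight⇒rel {dᵢ} {dⱼ} {eᵢ} {eⱼ} a a′ c c′ aeq ceq w w′ | pos-neg | pos-neg =
  squares⇒rel both-+ (sameWeight⇒squares (∣ a ∣) (∣ a′ ∣) (∣ c ∣) (∣ c′ ∣) dᵢ dⱼ eᵢ eⱼ
    (opposite⇒abs a a′ aeq) (opposite⇒abs c c′ ceq) w)
sameWeight⇒rel {dᵢ} {dⱼ} {eᵢ} {eⱼ} a a′ c c′ aeq ceq w w′ | neg-pos | neg-pos =
  squares⇒rel both-- (sameWeight⇒squares (∣ a ∣) (∣ a′ ∣) (∣ c ∣) (∣ c′ ∣) dᵢ dⱼ eᵢ eⱼ
    (opposite⇒abs a a′ aeq) (opposite⇒abs c c′ ceq)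
    (trans (ℕ.*-comm (∣ a ∣) (∣ a′ ∣)) (trans w′ (ℕ.*-comm (∣ c′ ∣) (∣ c ∣)))))

rel-rescale : ∀ {p q a c} y → Rel p q a c → Rel (p ℕ.* y) (q ℕ.* y) a c
rel-rescale {p} {q} {a} {c} y rel = ⟨ (begin
  φ c * + (q ℕ.* y)     ≡⟨ assoc (φ c) q ⟩
  φ c * + q * + y       ≡⟨ cong (_* + y) (rel .φ-eq) ⟩
  φ a * + p * + y       ≡⟨ assoc (φ a) p ⟨
  φ a * + (p ℕ.* y)     ∎) ⟩
  where
  open ≡-Reasoning
  assoc : ∀ x q → x * + (q ℕ.* y) ≡ x * + q * + y
  assoc x q = trans (cong (x *_) (ℤ.pos-* q y)) (sym (ℤ.*-assoc x (+ q) (+ y)))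

rel-0 : ∀ {p q a c} .{{_ : NonZero p}} .{{_ : NonZero q}} → a ≡ 0ℤ → Rel p q a c → c ≡ 0ℤ
rel-0 {a = a} {c} a≡0 rel with rel⇒sameSign a c rel
... | both-0 = refl

-- Rationality of the conjugating matrix up to a scalar.

data Reachable (B : Mat (suc n) (suc n)) : Fin (suc n) → Set where
  root : Reachable B zero
  step : ∀ {i j} → Reachable B i → B i j ≢ 0ℤ → Reachable B j

-- A fraction-free form of `√(q / p) = x / y`.
SquareRatio : ℕ → ℕ → Set
SquareRatio p q = ∃[ x ] ∃[ y ] NonZero y × x ℕ.* x ℕ.* p ≡ y ℕ.* y ℕ.* q

-- A nonzero entry forces `√(q′ / q) = ∣ a ∣ / ∣ c ∣`, so rationality spreads along the arrows.
squareRatio-rel : ∀ {p q q′ a c} .{{_ : NonZero q}} .{{_ : NonZero q′}} → a ≢ 0ℤ →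
  SquareRatio p q → Rel q q′ a c → SquareRatio p q′
squareRatio-rel {p} {q} {q′} {a} {c} a≢0 (x , y , y≢0 , eq) rel =
  x ℕ.* ∣ a ∣ , y ℕ.* ∣ c ∣ , ℕ.m*n≢0 y ∣ c ∣ {{y≢0}} {{c≢0 (rel⇒sameSign a c rel)}} , (begin
    x ℕ.* ∣ a ∣ ℕ.* (x ℕ.* ∣ a ∣) ℕ.* p        ≡⟨ lemma x ∣ a ∣ p ⟩
    ∣ a ∣ ℕ.* ∣ a ∣ ℕ.* (x ℕ.* x ℕ.* p)        ≡⟨ cong (∣ a ∣ ℕ.* ∣ a ∣ ℕ.*_) eq ⟩
    ∣ a ∣ ℕ.* ∣ a ∣ ℕ.* (y ℕ.* y ℕ.* q)        ≡⟨ lemma′ ∣ a ∣ y q ⟩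
    y ℕ.* y ℕ.* (∣ a ∣ ℕ.* ∣ a ∣ ℕ.* q)        ≡⟨ cong (y ℕ.* y ℕ.*_) (rel⇒squares rel) ⟨
    y ℕ.* y ℕ.* (∣ c ∣ ℕ.* ∣ c ∣ ℕ.* q′)       ≡⟨ lemma″ y ∣ c ∣ q′ ⟩
    y ℕ.* ∣ c ∣ ℕ.* (y ℕ.* ∣ c ∣) ℕ.* q′       ∎)
  where
  open ≡-Reasoning
  c≢0 : SameSign a c → NonZero ∣ c ∣
  c≢0 both-0 = ⊥-elim (a≢0 refl)
  c≢0 both-+ = _
  c≢0 both-- = _
  lemma : ∀ x a p → x ℕ.* a ℕ.* (x ℕ.* a) ℕ.* p ≡ a ℕ.* a ℕ.* (x ℕ.* x ℕ.* p)
  lemma = ℕ-Solver.solve-∀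
  lemma′ : ∀ a y q → a ℕ.* a ℕ.* (y ℕ.* y ℕ.* q) ≡ y ℕ.* y ℕ.* (a ℕ.* a ℕ.* q)
  lemma′ = ℕ-Solver.solve-∀
  lemma″ : ∀ y c q → y ℕ.* y ℕ.* (c ℕ.* c ℕ.* q) ≡ y ℕ.* c ℕ.* (y ℕ.* c) ℕ.* q
  lemma″ = ℕ-Solver.solve-∀

commonMultiple : (y : Fin n → ℕ) → (∀ i → NonZero (y i)) →
  ∃[ Y ] NonZero Y × ∀ i → ∃[ z ] Y ≡ z ℕ.* y i
commonMultiple {zero}  y y≢0 = 1 , _ , λ ()
commonMultiple {suc n} y y≢0 with Y , Y≢0 , mult ← commonMultiple (y ∘ suc) (y≢0 ∘ suc) =
  Y ℕ.* y zero , ℕ.m*n≢0 Y (y zero) {{Y≢0}} {{y≢0 zero}} , λ where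
    zero    → Y , refl
    (suc i) → let z , eq = mult i in
      z ℕ.* y zero , trans (cong (ℕ._* y zero) eq) (lemma z (y (suc i)) (y zero))
  where
  lemma : ∀ a b c → a ℕ.* b ℕ.* c ≡ a ℕ.* c ℕ.* b
  lemma = ℕ-Solver.solve-∀

-- A common denominator `Y` makes every `c i = Y √(q i / p)` a natural number.
commonScale : ∀ {p} {q : Fin n → ℕ} → (∀ i → SquareRatio p (q i)) →
  ∃[ Y ] NonZero Y × Σ (Fin n → ℕ) λ c → ∀ i → c i ℕ.* c i ℕ.* p ≡ q i ℕ.* (Y ℕ.* Y)
commonScale {n} {p} {q} ratio
  with Y , Y≢0 , mult ← commonMultiple (proj₁ ∘ proj₂ ∘ ratio) (proj₁ ∘ proj₂ ∘ proj₂ ∘ ratio)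
  = Y , Y≢0 , (λ i → proj₁ (ratio i) ℕ.* proj₁ (mult i)) , λ i →
    let x , y , _ , eq = ratio i
        z , Y≡zy = mult i
    in begin
      x ℕ.* z ℕ.* (x ℕ.* z) ℕ.* p        ≡⟨ lemma x z p ⟩
      z ℕ.* z ℕ.* (x ℕ.* x ℕ.* p)        ≡⟨ cong (z ℕ.* z ℕ.*_) eq ⟩
      z ℕ.* z ℕ.* (y ℕ.* y ℕ.* q i)      ≡⟨ lemma′ z y (q i) ⟩
      q i ℕ.* (z ℕ.* y ℕ.* (z ℕ.* y))    ≡⟨ cong (λ Y → q i ℕ.* (Y ℕ.* Y)) Y≡zy ⟨
      q i ℕ.* (Y ℕ.* Y)                  ∎
  where
  open ≡-Reasoning
  lemma : ∀ x z p → x ℕ.* z ℕ.* (x ℕ.* z) ℕ.* p ≡ z ℕ.* z ℕ.* (x ℕ.* x ℕ.* p)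
  lemma = ℕ-Solver.solve-∀
  lemma′ : ∀ z y q → z ℕ.* z ℕ.* (y ℕ.* y ℕ.* q) ≡ q ℕ.* (z ℕ.* y ℕ.* (z ℕ.* y))
  lemma′ = ℕ-Solver.solve-∀

-- Reduction of a whole class to its representative.

module _ (B₀ : Mat (suc n) (suc n)) (e : Fin (suc n) → ℕ)
  (e≢0 : ∀ i → NonZero (e i)) (skew : LeftSkew e B₀) (connected : ∀ i → Reachable B₀ i)
  (rigid : ∀ r → Bounded B₀ r → ∀ i → r i ≡ 0ℤ)
  where

  no-admissible : ∀ B → SkewSymmetrizable B → DiagramInClassOf B₀ B → ∀ b → ¬ Admissible B b
  no-admissible B (d , d>0 , Bskew) (ks , σ , iso) b (b≢0 , fin) =
    b≢0 λ i → ℤ.neg-injective (ρSeq-zero ls B (-_ ∘ b) r≡0 i)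
    where
    s : Fin (suc n) → Fin (suc n)
    s = σ ⟨$⟩ʳ_

    q : Fin (suc n) → ℕ
    -- Equal diagrams force corresponding nonzero entries of `B` and `M` to have squared ratio
    -- `q i / q j`.
    q i = d (s i) ℕ.* e i

    instance
      dnz : ∀ {i} → NonZero (d i)
      dnz {i} rewrite proj₂ (d>0 i) = _
      enz : ∀ {i} → NonZero (e i)
      enz {i} = e≢0 i
      qnz : ∀ {i} → NonZero (q i)
      qnz {i} = ℕ.m*n≢0 (d (s i)) (e i)

    module Q = Rescaling σ q

    M : Mat (suc n) (suc n)
    M = mutSeq μ ks B₀

    Mskew : LeftSkew e M
    Mskew = leftSkew-mutSeq ks skew

    unmutated : ∃[ ls ] Q.Scaling B₀ (mutSeq μ ls B)
    unmutated = Q.scaling-unmutate ks (Q.scaling λ i j →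
      sameWeight⇒rel (M i j) (M j i) (B (s i) (s j)) (B (s j) (s i))
        (Mskew i j) (Bskew (s i) (s j)) (iso i j) (iso j i))

    ls : List (Fin (suc n))
    ls = proj₁ unmutated

    B′ : Mat (suc n) (suc n)
    B′ = mutSeq μ ls B

    r : Row (suc n)
    r = ρSeq ls B (-_ ∘ b)

    ratio : ∀ {i} → Reachable B₀ i → SquareRatio (q zero) (q i)
    ratio root            = 1 , 1 , _ , refl
    ratio (step {i} {j} reach B₀≢0) =
      squareRatio-rel B₀≢0 (ratio reach) (Q.at (proj₂ unmutated) i j)

    scale : ∃[ Y ] NonZero Y × Σ (Fin (suc n) → ℕ) λ c →
      ∀ i → c i ℕ.* c i ℕ.* q zero ≡ q i ℕ.* (Y ℕ.* Y)
    scale = commonScale (ratio ∘ connected)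

    Y : ℕ
    Y = proj₁ scale

    c : Fin (suc n) → ℕ
    c = proj₁ (proj₂ (proj₂ scale))

    Q′ : Fin (suc n) → ℕ
    -- The common factor `Y²` leaves the conjugation of matrices unchanged and turns the row factors
    -- into the integers `c i`.
    Q′ i = q i ℕ.* (Y ℕ.* Y)

    instance
      Ynz : NonZero Y
      Ynz = proj₁ (proj₂ scale)
      YYnz : NonZero (Y ℕ.* Y)
      YYnz = ℕ.m*n≢0 Y Y
      Q′nz : ∀ {i} → NonZero (Q′ i)
      Q′nz {i} = ℕ.m*n≢0 (q i) (Y ℕ.* Y)

    module S = Rescaling σ Q′

    rescaled : S.Scaling B₀ B′
    rescaled = S.scaling λ i j → rel-rescale (Y ℕ.* Y) (Q.at (proj₂ unmutated) i j)

    r₀ : Row (suc n)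
    r₀ i = r (s i) * + c i

    row-rescaled : S.RowScaling (q zero) r₀ r
    row-rescaled = S.rowScaling λ i → ⟨ (begin
      φ (r (s i)) * + Q′ i                           ≡⟨ cong (λ z → φ (r (s i)) * + z) (proj₂ (proj₂ (proj₂ scale)) i) ⟨
      φ (r (s i)) * + (c i ℕ.* c i ℕ.* q zero)       ≡⟨ cong (φ (r (s i)) *_) (ℤ.pos-* (c i ℕ.* c i) (q zero)) ⟩
      φ (r (s i)) * (+ (c i ℕ.* c i) * + q zero)     ≡⟨ cong (λ z → φ (r (s i)) * (z * + q zero)) (ℤ.pos-* (c i) (c i)) ⟩
      φ (r (s i)) * (φ (+ c i) * + q zero)           ≡⟨ ℤ.*-assoc (φ (r (s i))) (φ (+ c i)) (+ q zero) ⟨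
      φ (r (s i)) * φ (+ c i) * + q zero             ≡⟨ cong (_* + q zero) (φ-* (r (s i)) (+ c i)) ⟨
      φ (r₀ i) * + q zero                            ∎) ⟩
      where open ≡-Reasoning

    r₀≡0 : ∀ i → r₀ i ≡ 0ℤ
    r₀≡0 = rigid r₀ (S.bounded-scaling rescaled row-rescaled
      (bounded-ρSeq ls (finite⇒bounded B b fin)))

    r≡0 : ∀ i → r i ≡ 0ℤ
    -- Every vertex is the relabelling of some `j`, and a scaled entry vanishes only with the
    -- original.
    r≡0 i = trans (cong r (sym (inverseʳ σ))) (rel-0 (r₀≡0 j) (S.at row-rescaled j))
      where
      j : Fin (suc n)
      j = σ ⟨$⟩ˡ i

-- Checked certificates for the four types.

leftSkew? : ∀ (e : Fin n → ℕ) B → Dec (LeftSkew e B)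
leftSkew? e B = all? λ i → all? λ j → (B i j * + e i) ℤ.≟ (- (B j i * + e j))

allNonZero? : ∀ (e : Fin n → ℕ) → Dec (∀ i → NonZero (e i))
allNonZero? e = all? λ i → ℕ.nonZero? (e i)

-- The data ks, i, j used for the four types were found by computer search.
no-admissible-with : ∀ (B₀ : Mat (suc (suc n)) (suc (suc n))) e ks i j →
  True (allNonZero? e) → True (leftSkew? e B₀) → (∀ v → Reachable B₀ v) →
  DoubleArrow B₀ zero (suc zero) → True (refutes? ks i j B₀ init) →
  ∀ B → SkewSymmetrizable B → DiagramInClassOf B₀ B → ∀ b → ¬ Admissible B b
no-admissible-with B₀ e ks i j e≢0 skew conn arrow ref =
  no-admissible B₀ e (toWitness e≢0) (toWitness skew) conn
    (λ r → bounded⇒zero ks {i} {j} arrow ref)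

theorem9p7 : (X : ExtAffineType) (B : Mat (rank X) (rank X)) →
    SkewSymmetrizable B → DiagramInClassOf (representative X) B →
    (b : Fin (rank X) → ℤ) → ¬ Admissible B b
-- The weights are `3 / d` for both `G₂` types and `2 / d` for both `F₄` types. Here, writing entry
-- 2 as `y` or `- y`, it ends as `- 3 x - y` or `- 3 x - 2 y` respectively.
theorem9p7 G₂⁽*,+⁾ = no-admissible-with _ (lookup (1 ∷ 1 ∷ 3 ∷ 3 ∷ []))
  (# 2 ∷ # 1 ∷ []) (# 2) (# 3) tt tt
  (λ where
    zero                   → root
    (suc zero)             → step root λ ()
    (suc (suc zero))       → step root λ ()
    (suc (suc (suc zero))) → step {i = # 2} (step root λ ()) λ ())
  (refl , refl) tt
-- Entry 0 ends as `- 2 x - y` for either sign of the unknown entry 2.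
theorem9p7 G₂⁽*,*⁾ = no-admissible-with _ (lookup (1 ∷ 1 ∷ 3 ∷ 1 ∷ []))
  (# 2 ∷ # 0 ∷ # 1 ∷ []) (# 0) (# 3) tt tt
  (λ where
    zero                   → root
    (suc zero)             → step root λ ()
    (suc (suc zero))       → step root λ ()
    (suc (suc (suc zero))) → step root λ ())
  (refl , refl) tt
-- The unknown entries 2, 3 and 4 produce eight sign branches, all served by one sequence; entry 5
-- is recovered from balance.
theorem9p7 F₄⁽*,+⁾ = no-admissible-with _ (lookup (1 ∷ 1 ∷ 2 ∷ 2 ∷ 1 ∷ 1 ∷ []))
  (# 2 ∷ # 1 ∷ # 3 ∷ # 4 ∷ # 1 ∷ # 2 ∷ []) (# 1) (# 5) tt tt
  (λ where
    zero                               → root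
    (suc zero)                         → step root λ ()
    (suc (suc zero))                   → step root λ ()
    (suc (suc (suc zero)))             → step {i = # 2} (step root λ ()) λ ()
    (suc (suc (suc (suc zero))))       → step root λ ()
    (suc (suc (suc (suc (suc zero))))) → step {i = # 4} (step root λ ()) λ ())
  (refl , refl) tt
-- Again eight branches, now from the entries 2, 3 and 5, with entry 4 recovered from balance.
theorem9p7 F₄⁽*,*⁾ = no-admissible-with _ (lookup (1 ∷ 1 ∷ 2 ∷ 2 ∷ 2 ∷ 1 ∷ []))
  (# 2 ∷ # 0 ∷ # 3 ∷ # 5 ∷ # 2 ∷ # 1 ∷ []) (# 2) (# 4) tt tt
  (λ where
    zero                               → root
    (suc zero)                         → step root λ ()
    (suc (suc zero))                   → step root λ ()
    (suc (suc (suc zero)))             → step {i = # 2} (step root λ ()) λ ()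
    (suc (suc (suc (suc zero))))       → step {i = # 3} (step {i = # 2} (step root λ ()) λ ()) λ ()
    (suc (suc (suc (suc (suc zero))))) → step root λ ())
  (refl , refl) tt
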